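{- For every $n,k\in\mathbb N$ with $n\ge 2k$, $$ex_<(n,\{\text{Cross- }\mathcal M_k,\text{Sep- }\mathcal M_k\})\le (k-1)n-\binom{2k-1}{2}+\binom{k}{2}+(k-1)\left(\binom{k+1}{2}-1\right).$$ Furthermore, equality holds provided $n\ge 2k^2$.
   Context: An ordered graph on $n$ vertices has vertex set $[n]$ with its natural order. An ordered graph $G$ contains a copy of an ordered graph $H$ if there is an injective, order-preserving map $V(H)\to V(G)$ sending edges to edges. For a family $\mathcal H$ of ordered graphs, $ex_<(n,\mathcal H)$ is the maximum number of edges of an ordered graph on $[n]$ containing no copy of any member of $\mathcal H$. Two vertex-disjoint edges $xy$, $uv$ with $x<y$, $u<v$ are separated if $[x,y]\cap[u,v]=\emptyset$; nested if one interval contains the other; crossing otherwise. A $k$-matching is a set of $k$ pairwise vertex-disjoint edges. $\text{Cross- }\mathcal M_k$ (resp. $\text{Sep- }\mathcal M_k$) is the crossing (resp. separated) $k$-matching, i.e. a $k$-matching every pair of whose edges cross (resp. are separated). Thus the quantity is the maximum number of edges of an ordered graph on $[n]$ containing neither a crossing $k$-matching nor a separated $k$-matching. -}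

module Defs where

open import Data.Nat as ℕ using (ℕ; _+_; _*_)
open import Data.Fin using (Fin; _<_; _≤_; _<?_)
open import Data.Fin.Base using (toℕ)
open import Data.Bool using (Bool; true; false; if_then_else_; _∧_)
open import Data.List using (List; map)
open import Data.Nat.ListAction using (sum)
open import Data.List.Base using (allFin)
open import Data.Product using (_×_; Σ)
open import Data.Sum using (_⊎_)
open import Relation.Nullary using (¬_)
open import Relation.Nullary.Decidable using (⌊_⌋)
open import Relation.Binary.PropositionalEquality using (_≡_; _≢_)

-- An ordered graph on [n] = Fin n (natural order).  Only the values
-- adj i j with i < j matter: the edge set is { ij : i < j, adj i j = true }.
record OGraph (n : ℕ) : Set where
  field
    adj : Fin n → Fin n → Bool
open OGraph public

IsEdge : {n : ℕ} → OGraph n → Fin n → Fin n → Set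
IsEdge G i j = (i < j) × (adj G i j ≡ true)

edgeCount : {n : ℕ} → OGraph n → ℕ
edgeCount {n} G =
  sum (map (λ i → sum (map (λ j → if ⌊ i <? j ⌋ ∧ adj G i j then 1 else 0)
                           (allFin n)))
           (allFin n))

Disjoint : {n : ℕ} → Fin n → Fin n → Fin n → Fin n → Set
Disjoint x y u v = (x ≢ u) × (x ≢ v) × (y ≢ u) × (y ≢ v)

Separated : {n : ℕ} → Fin n → Fin n → Fin n → Fin n → Set
Separated x y u v = (y < u) ⊎ (v < x)

Nested : {n : ℕ} → Fin n → Fin n → Fin n → Fin n → Set
Nested x y u v = ((x ≤ u) × (v ≤ y)) ⊎ ((u ≤ x) × (y ≤ v))

Crossing : {n : ℕ} → Fin n → Fin n → Fin n → Fin n → Set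
Crossing x y u v = ¬ Separated x y u v × ¬ Nested x y u v

HasMatching : {n : ℕ} → (Fin n → Fin n → Fin n → Fin n → Set) →
              OGraph n → ℕ → Set
HasMatching {n} R G k =
  Σ (Fin k → Fin n) λ x → Σ (Fin k → Fin n) λ y →
    ((a : Fin k) → IsEdge G (x a) (y a)) ×
    ((a b : Fin k) → a ≢ b →
       Disjoint (x a) (y a) (x b) (y b) × R (x a) (y a) (x b) (y b))

HasCrossM : {n : ℕ} → OGraph n → ℕ → Set
HasCrossM G k = HasMatching Crossing G k

HasSepM : {n : ℕ} → OGraph n → ℕ → Set
HasSepM G k = HasMatching Separated G k

Free : {n : ℕ} → OGraph n → ℕ → Set
Free G k = ¬ HasCrossM G k × ¬ HasSepM G k

{-# OPTIONS --safe #-}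
module Submission where

-- Write r = k - 1.  If no r + 1 edges are pairwise separated, the greedy choice of leftmost right ends
-- yields r points meeting every edge, so at most r (C(r+2,2) - 1) edges have length at most r.
-- For the longer edges we use the Capoyleas-Pach theorem: without r + 1 pairwise crossing edges, a graph on
-- n >= 2r + 1 points in convex position has at most 2rn - C(2r+1,2) edges.  Its proof is by induction on n:
-- call an edge near if its cyclic length is at most r; near edges lie in no crossing (r+1)-matching.
-- Cut the polygon along an edge e that is not near.  The edges crossing e contain no crossing r-matching;
-- give each of them as level the length of the longest crossing chain ending in it.  Each of the r - 1
-- levels is an antitone lattice path, so it has fewer edges than endpoints, and these endpoints are joined
-- to one new vertex per level in each of the two pieces.  Neither piece acquires a crossing (r+1)-matching.
-- For equality take all edges from {0..r-1} to {r..n-1}, and all edges of length at most r that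
-- contain one of the r points t (r + 1) + r, t < r.

open import Defs
open import Data.Nat
open import Data.Nat.Properties
open import Data.Nat.Combinatorics using (_C_; nC1≡n; nCk+nC[k+1]≡[n+1]C[k+1])
open import Data.Nat.Induction using (<-rec)
open import Data.Nat.ListAction using (sum)
open import Data.Nat.Tactic.RingSolver using (solve-∀)
open import Data.Bool using (Bool; true; false; if_then_else_; _∧_)
import Data.Bool.Properties as Bool
open import Data.Empty using (⊥; ⊥-elim)
open import Data.Fin as Fin using (Fin; toℕ)
import Data.Fin.Properties as Fin
open import Data.List.Base using (allFin; map; tabulate)
import Data.List.Properties as List
open import Data.Product using (Σ; ∃; _×_; _,_; proj₁; proj₂)
open import Data.Sum using (_⊎_; inj₁; inj₂; [_,_]′)
open import Function using (_∘_; id)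
open import Relation.Binary.Definitions using (tri<; tri≈; tri>)
open import Relation.Binary.PropositionalEquality
open import Relation.Nullary using (¬_; Dec; yes; no)
open import Relation.Nullary.Decidable using (_×-dec_; _⊎-dec_; ¬?; map′; ⌊_⌋; dec-true; isYes≗does)

-- Finite sums and counting

sumTo : ℕ → (ℕ → ℕ) → ℕ
sumTo zero    f = 0
sumTo (suc n) f = f 0 + sumTo n (f ∘ suc)

sumTo-mono : ∀ n {f g : ℕ → ℕ} → (∀ i → i < n → f i ≤ g i) → sumTo n f ≤ sumTo n g
sumTo-mono zero    f≤g = z≤n
sumTo-mono (suc n) f≤g = +-mono-≤ (f≤g 0 z<s) (sumTo-mono n λ i i<n → f≤g (suc i) (s<s i<n))

sumTo-cong : ∀ n {f g : ℕ → ℕ} → (∀ i → f i ≡ g i) → sumTo n f ≡ sumTo n g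
sumTo-cong zero    f≡g = refl
sumTo-cong (suc n) f≡g = cong₂ _+_ (f≡g 0) (sumTo-cong n (f≡g ∘ suc))

+-interchange : ∀ a b c d → (a + b) + (c + d) ≡ (a + c) + (b + d)
+-interchange = solve-∀

sumTo-+ : ∀ n (f g : ℕ → ℕ) → sumTo n (λ i → f i + g i) ≡ sumTo n f + sumTo n g
sumTo-+ zero    f g = refl
sumTo-+ (suc n) f g = trans (cong ((f 0 + g 0) +_) (sumTo-+ n (f ∘ suc) (g ∘ suc)))
  (+-interchange (f 0) (g 0) (sumTo n (f ∘ suc)) (sumTo n (g ∘ suc)))

sumTo-const : ∀ n c → sumTo n (λ _ → c) ≡ n * c
sumTo-const zero    c = refl
sumTo-const (suc n) c = cong (c +_) (sumTo-const n c)

sumTo-zero : ∀ n → sumTo n (λ _ → 0) ≡ 0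
sumTo-zero n = trans (sumTo-const n 0) (*-zeroʳ n)

sumTo-swap : ∀ m n (f : ℕ → ℕ → ℕ) →
  sumTo m (λ i → sumTo n (f i)) ≡ sumTo n (λ j → sumTo m (λ i → f i j))
sumTo-swap zero    n f = sym (sumTo-zero n)
sumTo-swap (suc m) n f = trans (cong (sumTo n (f 0) +_) (sumTo-swap m n (f ∘ suc)))
  (sym (sumTo-+ n (f 0) (λ j → sumTo m (λ i → f (suc i) j))))

sumTo-split : ∀ m n (f : ℕ → ℕ) → sumTo (m + n) f ≡ sumTo m f + sumTo n (λ i → f (m + i))
sumTo-split zero    n f = refl
sumTo-split (suc m) n f = trans (cong (f 0 +_) (sumTo-split m n (f ∘ suc)))
  (sym (+-assoc (f 0) (sumTo m (f ∘ suc)) _))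

sumTo-last : ∀ n (f : ℕ → ℕ) → sumTo (suc n) f ≡ sumTo n f + f n
sumTo-last zero    f = +-identityʳ (f 0)
sumTo-last (suc n) f = trans (cong (f 0 +_) (sumTo-last n (f ∘ suc)))
  (sym (+-assoc (f 0) (sumTo n (f ∘ suc)) (f (suc n))))

sumTo-grow : ∀ {m n} (f : ℕ → ℕ) → m ≤ n → sumTo m f ≤ sumTo n f
sumTo-grow f z≤n       = z≤n
sumTo-grow f (s≤s m≤n) = +-monoʳ-≤ (f 0) (sumTo-grow (f ∘ suc) m≤n)

-- The binomial coefficient `n C 2` (see `tri-C`), defined by recursion so that it meets the sums
-- below directly.
tri : ℕ → ℕ
tri zero    = 0
tri (suc n) = n + tri n

sumTo-id : ∀ n → sumTo n id ≡ tri n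
sumTo-id zero    = refl
sumTo-id (suc n) = trans (sumTo-last n id) (trans (cong (_+ n) (sumTo-id n)) (+-comm (tri n) n))

-- Subtraction-free form of 2 C(n,2) = n (n - 1).
tri-double : ∀ n → tri n + tri n + n ≡ n * n
tri-double zero    = refl
tri-double (suc n) = trans (step n (tri n))
  (trans (cong (λ t → t + (n + suc n)) (tri-double n)) (square n))
  where
  step : ∀ n t → (n + t) + (n + t) + suc n ≡ (t + t + n) + (n + suc n)
  step = solve-∀
  square : ∀ n → n * n + (n + suc n) ≡ suc n * suc n
  square = solve-∀

ind : {P : Set} → Dec P → ℕ
ind (yes _) = 1
ind (no  _) = 0

ind≤1 : {P : Set} (P? : Dec P) → ind P? ≤ 1
ind≤1 (yes _) = ≤-refl
ind≤1 (no  _) = z≤n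

ind-true : {P : Set} (P? : Dec P) → P → 1 ≤ ind P?
ind-true (yes _) p = ≤-refl
ind-true (no ¬p) p = ⊥-elim (¬p p)

ind-false : {P : Set} (P? : Dec P) → ¬ P → ind P? ≤ 0
ind-false (yes p) ¬p = ⊥-elim (¬p p)
ind-false (no _)  ¬p = z≤n

ind-mono : {P Q : Set} (P? : Dec P) (Q? : Dec Q) → (P → Q) → ind P? ≤ ind Q?
ind-mono (yes p) Q? f = ind-true Q? (f p)
ind-mono (no _)  Q? f = z≤n

ind-cover : {P Q R : Set} (P? : Dec P) (Q? : Dec Q) (R? : Dec R) →
  (P → Q ⊎ R) → ind P? ≤ ind Q? + ind R?
ind-cover (no _)  Q? R? f = z≤n
ind-cover (yes p) Q? R? f with f p
... | inj₁ q = ≤-trans (ind-true Q? q) (m≤m+n _ _)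
... | inj₂ r = ≤-trans (ind-true R? r) (m≤n+m _ _)

ind-pack : {P Q R : Set} (P? : Dec P) (Q? : Dec Q) (R? : Dec R) →
  (P → R) → (Q → R) → (P → Q → ⊥) → ind P? + ind Q? ≤ ind R?
ind-pack (yes p) (yes q) R? f g dis = ⊥-elim (dis p q)
ind-pack (yes p) (no _)  R? f g dis = ind-true R? (f p)
ind-pack (no _)  Q?      R? f g dis = ind-mono Q? R? g

count : {P : ℕ → Set} → (∀ i → Dec (P i)) → ℕ → ℕ
count P? n = sumTo n (λ i → ind (P? i))

module _ {P : ℕ → Set} (P? : ∀ i → Dec (P i)) where

  count-none : ∀ n → (∀ i → i < n → ¬ P i) → count P? n ≡ 0
  count-none n none = n≤0⇒n≡0 (≤-trans (sumTo-mono n λ i i<n → ind-false (P? i) (none i i<n))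
    (≤-reflexive (sumTo-zero n)))

  count-all : ∀ n → (∀ i → i < n → P i) → n ≤ count P? n
  count-all n all = ≤-trans (≤-reflexive (sym (trans (sumTo-const n 1) (*-identityʳ n))))
    (sumTo-mono n λ i i<n → ind-true (P? i) (all i i<n))

  count-≤ : ∀ n → count P? n ≤ n
  count-≤ n = ≤-trans (sumTo-mono n λ i _ → ind≤1 (P? i))
    (≤-reflexive (trans (sumTo-const n 1) (*-identityʳ n)))

count-mono : {P Q : ℕ → Set} (P? : ∀ i → Dec (P i)) (Q? : ∀ i → Dec (Q i)) →
  ∀ n → (∀ i → i < n → P i → Q i) → count P? n ≤ count Q? n
count-mono P? Q? n f = sumTo-mono n λ i i<n → ind-mono (P? i) (Q? i) (f i i<n)

count-cover : {P Q R : ℕ → Set} (P? : ∀ i → Dec (P i)) (Q? : ∀ i → Dec (Q i)) (R? : ∀ i → Dec (R i)) →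
  ∀ n → (∀ i → i < n → P i → Q i ⊎ R i) → count P? n ≤ count Q? n + count R? n
count-cover P? Q? R? n f = ≤-trans
  (sumTo-mono n λ i i<n → ind-cover (P? i) (Q? i) (R? i) (f i i<n))
  (≤-reflexive (sumTo-+ n _ _))

count-pack : {P Q R : ℕ → Set} (P? : ∀ i → Dec (P i)) (Q? : ∀ i → Dec (Q i)) (R? : ∀ i → Dec (R i)) →
  ∀ n → (∀ i → i < n → P i → R i) → (∀ i → i < n → Q i → R i) → (∀ i → i < n → P i → Q i → ⊥) →
  count P? n + count Q? n ≤ count R? n
count-pack P? Q? R? n f g dis = ≤-trans (≤-reflexive (sym (sumTo-+ n _ _)))
  (sumTo-mono n λ i i<n → ind-pack (P? i) (Q? i) (R? i) (f i i<n) (g i i<n) (dis i i<n))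

count-subsingleton : {P : ℕ → Set} (P? : ∀ i → Dec (P i)) → ∀ n →
  (∀ {i j} → i < j → P i → P j → ⊥) → count P? n ≤ 1
count-subsingleton P? zero    uniq = z≤n
count-subsingleton P? (suc n) uniq with P? 0
... | yes p = s≤s (≤-reflexive (count-none (P? ∘ suc) n λ i _ → uniq z<s p))
... | no  _ = count-subsingleton (P? ∘ suc) n (uniq ∘ s<s)

-- Two sets, all of P lying weakly below all of Q, share at most one element.
count-touching : {P Q R : ℕ → Set} (P? : ∀ i → Dec (P i)) (Q? : ∀ i → Dec (Q i)) (R? : ∀ i → Dec (R i)) →
  ∀ n → (∀ i → i < n → P i → R i) → (∀ i → i < n → Q i → R i) →
  (∀ {i j} → Q i → P j → i < j → ⊥) → count P? n + count Q? n ≤ count R? n + 1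
count-touching {P} {Q} {R} P? Q? R? n f g below = begin
  count P? n + count Q? n                  ≡⟨ sumTo-+ n _ _ ⟨
  sumTo n (λ i → ind (P? i) + ind (Q? i))  ≤⟨ sumTo-mono n pointwise ⟩
  sumTo n (λ i → ind (R? i) + ind (B? i))  ≡⟨ sumTo-+ n _ _ ⟩
  count R? n + count B? n                  ≤⟨ +-monoʳ-≤ (count R? n) (count-subsingleton B? n
                                                λ i<j pi pj → below (proj₂ pi) (proj₁ pj) i<j) ⟩
  count R? n + 1                           ∎
  where
  open ≤-Reasoning
  B? : ∀ i → Dec (P i × Q i)
  B? i = P? i ×-dec Q? i
  pointwise : ∀ i → i < n → ind (P? i) + ind (Q? i) ≤ ind (R? i) + ind (B? i)
  pointwise i i<n with P? i | Q? i
  ... | yes p | yes q = +-mono-≤ (ind-true (R? i) (f i i<n p)) ≤-refl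
  ... | yes p | no _  = ≤-trans (ind-true (R? i) (f i i<n p)) (m≤m+n _ _)
  ... | no _  | yes q = ≤-trans (ind-true (R? i) (g i i<n q)) (m≤m+n _ _)
  ... | no _  | no _  = z≤n

-- Antitone lattice paths

rectCount : {E : ℕ → ℕ → Set} → (∀ i j → Dec (E i j)) → ℕ → ℕ → ℕ
rectCount E? m n = sumTo m (λ i → count (E? i) n)

-- In the grid such points form a staircase, running weakly down from left to right.
Antitone : (ℕ → ℕ → Set) → Set
Antitone E = ∀ {i j i' j'} → E i j → E i' j' → i < i' → j < j' → ⊥

rowHit? : {E : ℕ → ℕ → Set} (E? : ∀ i j → Dec (E i j)) (n : ℕ) → ∀ i → Dec (∃ λ j → j < n × E i j)
rowHit? E? n i = anyUpTo? (E? i) n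

colHit? : {E : ℕ → ℕ → Set} (E? : ∀ i j → Dec (E i j)) (m : ℕ) → ∀ j → Dec (∃ λ i → i < m × E i j)
colHit? E? m j = anyUpTo? (λ i → E? i j) m

-- The last row and the columns of the other rows overlap in at most one point.
antitone-count : {E : ℕ → ℕ → Set} (E? : ∀ i j → Dec (E i j)) → ∀ m n → Antitone E →
  1 ≤ rectCount E? m n →
  rectCount E? m n + 1 ≤ count (rowHit? E? n) m + count (colHit? E? m) n
antitone-count E? zero    n anti ()
antitone-count {E} E? (suc m) n anti nonempty = begin
  rectCount E? (suc m) n + 1 ≡⟨ cong (_+ 1) (sumTo-last m _) ⟩
  S + R + 1                  ≤⟨ cases ⟩
  X + ind (rowHit? E? n m) + Y' ≡⟨ cong (_+ Y') (sym (sumTo-last m _)) ⟩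
  count (rowHit? E? n) (suc m) + Y' ∎
  where
  open ≤-Reasoning
  S = rectCount E? m n
  R = count (E? m) n
  X = count (rowHit? E? n) m
  Y = count (colHit? E? m) n
  Y' = count (colHit? E? (suc m)) n
  IH : 1 ≤ S → S + 1 ≤ X + Y
  IH = antitone-count E? m n anti
  Y≤Y' : Y ≤ Y'
  Y≤Y' = count-mono (colHit? E? m) (colHit? E? (suc m)) n λ j _ (i , i<m , e) → i , m≤n⇒m≤1+n i<m , e
  R≤Y' : R ≤ Y'
  R≤Y' = count-mono (E? m) (colHit? E? (suc m)) n λ j _ e → m , ≤-refl , e
  touch : R + Y ≤ Y' + 1
  touch = count-touching (E? m) (colHit? E? m) (colHit? E? (suc m)) n
    (λ j _ e → m , ≤-refl , e) (λ j _ (i , i<m , e) → i , m≤n⇒m≤1+n i<m , e)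
    (λ (i , i<m , e) e' j<j' → anti e e' i<m j<j')
  cases : S + R + 1 ≤ X + ind (rowHit? E? n m) + Y'
  cases with rowHit? E? n m
  ... | no none = begin
    S + R + 1 ≡⟨ cong (λ t → S + t + 1) R≡0 ⟩
    S + 0 + 1 ≡⟨ cong (_+ 1) (+-identityʳ S) ⟩
    S + 1     ≤⟨ IH S≥1 ⟩
    X + Y     ≤⟨ +-mono-≤ (≤-reflexive (sym (+-identityʳ X))) Y≤Y' ⟩
    X + 0 + Y' ∎
    where
    R≡0 : R ≡ 0
    R≡0 = count-none (E? m) n λ j j<n e → none (j , j<n , e)
    S≥1 : 1 ≤ S
    S≥1 = ≤-trans nonempty (≤-reflexive (trans (sumTo-last m _) (trans (cong (S +_) R≡0) (+-identityʳ S))))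
  ... | yes _ with S in eq
  ...   | zero = begin
    R + 1       ≤⟨ +-monoˡ-≤ 1 R≤Y' ⟩
    Y' + 1      ≡⟨ +-comm Y' 1 ⟩
    1 + Y'      ≤⟨ +-monoˡ-≤ Y' (m≤n+m 1 X) ⟩
    X + 1 + Y'  ∎
  ...   | suc s = +-cancelʳ-≤ 1 _ _ (begin
    suc s + R + 1 + 1   ≡⟨ regroup (suc s) R ⟩
    (suc s + 1) + R + 1 ≤⟨ +-monoˡ-≤ 1 (+-monoˡ-≤ R
                             (subst (λ t → t + 1 ≤ X + Y) eq (IH (subst (1 ≤_) (sym eq) (s≤s z≤n))))) ⟩
    X + Y + R + 1       ≡⟨ regroup' X Y R ⟩
    X + 1 + (R + Y)     ≤⟨ +-monoʳ-≤ (X + 1) touch ⟩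
    X + 1 + (Y' + 1)    ≡⟨ sym (+-assoc (X + 1) Y' 1) ⟩
    X + 1 + Y' + 1      ∎)
    where
    regroup : ∀ s r → s + r + 1 + 1 ≡ (s + 1) + r + 1
    regroup = solve-∀
    regroup' : ∀ x y r → x + y + r + 1 ≡ x + 1 + (r + y)
    regroup' = solve-∀

-- Edge counts, grouped by right end

pairs : {E : ℕ → ℕ → Set} → (∀ a b → Dec (E a b)) → ℕ → ℕ
pairs E? n = sumTo n (λ b → count (λ a → E? a b) b)

pairs-mono : {E F : ℕ → ℕ → Set} (E? : ∀ a b → Dec (E a b)) (F? : ∀ a b → Dec (F a b)) → ∀ n →
  (∀ a b → a < b → b < n → E a b → F a b) → pairs E? n ≤ pairs F? n
pairs-mono E? F? n f = sumTo-mono n λ b b<n → count-mono _ _ b λ a a<b → f a b a<b b<n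

pairs-cover : {E F H : ℕ → ℕ → Set} (E? : ∀ a b → Dec (E a b)) (F? : ∀ a b → Dec (F a b))
  (H? : ∀ a b → Dec (H a b)) → ∀ n →
  (∀ a b → a < b → b < n → E a b → F a b ⊎ H a b) → pairs E? n ≤ pairs F? n + pairs H? n
pairs-cover E? F? H? n f = ≤-trans
  (sumTo-mono n λ b b<n → count-cover (λ a → E? a b) (λ a → F? a b) (λ a → H? a b) b λ a a<b → f a b a<b b<n)
  (≤-reflexive (sumTo-+ n _ _))

pairs-pack : {E F H : ℕ → ℕ → Set} (E? : ∀ a b → Dec (E a b)) (F? : ∀ a b → Dec (F a b))
  (H? : ∀ a b → Dec (H a b)) → ∀ n →
  (∀ a b → a < b → b < n → E a b → H a b) → (∀ a b → a < b → b < n → F a b → H a b) →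
  (∀ a b → a < b → b < n → E a b → F a b → ⊥) → pairs E? n + pairs F? n ≤ pairs H? n
pairs-pack E? F? H? n f g dis = ≤-trans (≤-reflexive (sym (sumTo-+ n _ _)))
  (sumTo-mono n λ b b<n → count-pack (λ a → E? a b) (λ a → F? a b) (λ a → H? a b) b
    (λ a a<b → f a b a<b b<n) (λ a a<b → g a b a<b b<n) (λ a a<b → dis a b a<b b<n))

pairs-≤tri : {E : ℕ → ℕ → Set} (E? : ∀ a b → Dec (E a b)) → ∀ n → pairs E? n ≤ tri n
pairs-≤tri E? n = ≤-trans (sumTo-mono n λ b _ → count-≤ (λ a → E? a b) b) (≤-reflexive (sumTo-id n))

pairs-complete : {E : ℕ → ℕ → Set} (E? : ∀ a b → Dec (E a b)) → ∀ n →
  (∀ a b → a < b → b < n → E a b) → tri n ≤ pairs E? n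
pairs-complete E? n all = ≤-trans (≤-reflexive (sym (sumTo-id n)))
  (sumTo-mono n λ b b<n → count-all (λ a → E? a b) b λ a a<b → all a b a<b b<n)

-- The vertices are split as 0, the α vertices 1 + i, the vertex 1 + α and the β vertices 2 + α + j.
pairs-blocks : {E : ℕ → ℕ → Set} (E? : ∀ a b → Dec (E a b)) → ∀ α β →
  pairs E? (2 + α + β) ≡
    pairs E? (2 + α)
    + (sumTo β (λ j → ind (E? 0 (2 + α + j)))
    + (sumTo β (λ j → sumTo α (λ i → ind (E? (1 + i) (2 + α + j))))
    + pairs (λ a b → E? (1 + α + a) (1 + α + b)) (1 + β)))
pairs-blocks E? α β = begin
  pairs E? (2 + α + β)
    ≡⟨ sumTo-split (2 + α) β (λ b → count (λ a → E? a b) b) ⟩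
  pairs E? (2 + α) + sumTo β (λ j → count (λ a → E? a (2 + α + j)) (2 + α + j))
    ≡⟨ cong (pairs E? (2 + α) +_) (sumTo-cong β column) ⟩
  pairs E? (2 + α) + sumTo β (λ j → first j + (middle j + upper j))
    ≡⟨ cong (pairs E? (2 + α) +_) (sumTo-+ β first (λ j → middle j + upper j)) ⟩
  pairs E? (2 + α) + (sumTo β first + sumTo β (λ j → middle j + upper j))
    ≡⟨ cong (λ t → pairs E? (2 + α) + (sumTo β first + t)) (sumTo-+ β middle upper) ⟩
  pairs E? (2 + α) + (sumTo β first + (sumTo β middle + sumTo β upper)) ∎
  where
  open ≡-Reasoning
  first middle upper : ℕ → ℕ
  first  j = ind (E? 0 (2 + α + j))
  middle j = sumTo α (λ i → ind (E? (1 + i) (2 + α + j)))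
  upper  j = sumTo (suc j) (λ a → ind (E? (1 + α + a) (1 + α + suc j)))
  column : ∀ j → count (λ a → E? a (2 + α + j)) (2 + α + j) ≡ first j + (middle j + upper j)
  column j = cong (first j +_) (begin
    sumTo (suc α + j) h                              ≡⟨ cong (λ t → sumTo t h) (+-suc α j) ⟨
    sumTo (α + suc j) h                              ≡⟨ sumTo-split α (suc j) h ⟩
    middle j + sumTo (suc j) (λ a → h (α + a))
      ≡⟨ cong (λ t → middle j + sumTo (suc j) (λ a → ind (E? (1 + α + a) (suc t)))) (+-suc α j) ⟨
    middle j + upper j                               ∎)
    where
    h : ℕ → ℕ
    h a = ind (E? (suc a) (2 + α + j))

-- Chains of crossing edges

-- The index `l` is the number of edges minus one, and `x`, `y` are the ends of the last edge, so
-- that the level of an edge can be read off the chains indexed by it.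
data Chain (P : ℕ → ℕ → Set) : ℕ → ℕ → ℕ → Set where
  single : ∀ {x y} → P x y → Chain P 0 x y
  extend : ∀ {l x' y' x y} → Chain P l x' y' → x' < x → y' < y → P x y → Chain P (suc l) x y

last : ∀ {P l x y} → Chain P l x y → P x y
last (single p)       = p
last (extend _ _ _ p) = p

Chain-map : ∀ {P Q : ℕ → ℕ → Set} → (f g : ℕ → ℕ) →
  (∀ {a b} → a < b → f a < f b) → (∀ {a b} → a < b → g a < g b) →
  (∀ {a b} → P a b → Q (f a) (g b)) → ∀ {l x y} → Chain P l x y → Chain Q l (f x) (g y)
Chain-map f g f< g< h (single p)       = single (h p)
Chain-map f g f< g< h (extend c u v p) = extend (Chain-map f g f< g< h c) (f< u) (g< v) (h p)

Chain-height : ∀ {P l x y} → Chain P l x y → l ≤ x × l ≤ y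
Chain-height (single _)       = z≤n , z≤n
Chain-height (extend c u v _) = ≤-trans (s≤s (proj₁ (Chain-height c))) u , ≤-trans (s≤s (proj₂ (Chain-height c))) v

chain? : ∀ {P} → (∀ a b → Dec (P a b)) → ∀ l x y → Dec (Chain P l x y)
chain? P? zero    x y = map′ single last (P? x y)
chain? P? (suc l) x y = map′
  (λ ((x' , u , y' , v , c) , p) → extend c u v p)
  (λ { (extend c u v p) → (_ , u , _ , v , c) , p })
  (anyUpTo? (λ x' → anyUpTo? (λ y' → chain? P? l x' y') y) x ×-dec P? x y)

module Levels {K : ℕ → ℕ → Set} (K? : ∀ i j → Dec (K i j)) where

  -- A longest chain ending in the edge has `l + 1` edges: chains can be shortened at their start,
  -- so excluding index `suc l` excludes all larger ones.
  Level : ℕ → ℕ → ℕ → Set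
  Level l i j = Chain K l i j × ¬ Chain K (suc l) i j

  level? : ∀ l i j → Dec (Level l i j)
  level? l i j = chain? K? l i j ×-dec ¬? (chain? K? (suc l) i j)

  -- If one edge of level `l` preceded another in both ends, its chain could be extended by the
  -- other, whose level would exceed `l`.
  level-antitone : ∀ {l} → Antitone (Level l)
  level-antitone (c , _) (c' , none) u v = none (extend c u v (last c'))

  -- In a longest chain the predecessor of the last edge has level exactly one less, since any
  -- longer chain ending in it could be extended; this is iterated down to `l'`.
  level-below : ∀ {l l' i j} → Level l i j → l' < l →
    ∃ λ i' → ∃ λ j' → i' < i × j' < j × Level l' i' j'
  level-below {suc l} {l'} (extend {x' = i'} {y' = j'} c u v p , none) l'<l with m≤n⇒m<n∨m≡n (s≤s⁻¹ l'<l)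
  ... | inj₂ refl = i' , j' , u , v , c , λ c' → none (extend c' u v p)
  ... | inj₁ l'<l₀ with level-below (c , λ c' → none (extend c' u v p)) l'<l₀
  ...   | i'' , j'' , u' , v' , lev = i'' , j'' , <-trans u' u , <-trans v' v , lev

-- Among edges straddling a common cut c, crossing is a strict order, so crossing matchings are chains.
Over : ℕ → ℕ → (ℕ → ℕ → Set) → ℕ → ℕ → Set
Over n c A a b = A a b × a < c × c ≤ b × b < n

-- `r` is a chain index, so `r + 1` edges are forbidden. Letting the cut `c` vary covers all
-- crossing matchings, as pairwise crossing edges straddle a common cut.
CrossFree : ℕ → ℕ → (ℕ → ℕ → Set) → Set
CrossFree r n A = ∀ {c x y} → ¬ Chain (Over n c A) r x y

-- Cyclic length at most r on an n-gon: such edges are in no crossing (r+1)-matching.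
Near : ℕ → ℕ → ℕ → ℕ → Set
Near r n a b = b ≤ a + r ⊎ n + a ≤ b + r

near? : ∀ r n a b → Dec (Near r n a b)
near? r n a b = (b ≤? a + r) ⊎-dec (n + a ≤? b + r)

-- Near pairs are adjoined at no cost (`CrossFree-Plus`); in the pieces of a cut they make up part
-- of the edges that the count requires.
Plus : ℕ → ℕ → (ℕ → ℕ → Set) → ℕ → ℕ → Set
Plus r n A a b = A a b ⊎ Near r n a b

plus? : ∀ r n {A : ℕ → ℕ → Set} → (∀ a b → Dec (A a b)) → ∀ a b → Dec (Plus r n A a b)
plus? r n A? a b = A? a b ⊎-dec near? r n a b

Over-height : ∀ {n c A l x y} → Chain (Over n c A) l x y → c + l ≤ y
Over-height {c = c} (single (_ , _ , c≤b , _)) = ≤-trans (≤-reflexive (+-identityʳ c)) c≤b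
Over-height {c = c} (extend {l} ch _ v _) = ≤-trans (≤-reflexive (+-suc c l)) (≤-trans (s≤s (Over-height ch)) v)

-- `d` is the number of edges that follow `x y` in a full chain, which has `l` edges before it and
-- `l + d = r`. From `x + d < c` and `c + l ≤ y` the length exceeds `r`; from `y + d < n` and
-- `l ≤ x` so does the length the other way round. Hence no edge of the chain is near.
strip-near : ∀ {r n c A l x y} d → l + d ≡ r → x + d < c → y + d < n →
  Chain (Over n c (Plus r n A)) l x y → Chain (Over n c A) l x y
strip-near {r} {n} {c} {A} {l} {x} {y} d eq x+d<c y+d<n ch = go ch (proj₁ (last ch))
  where
  open ≤-Reasoning
  far : ¬ Near r n x y
  far (inj₁ y≤x+r) = <-irrefl refl (begin-strict
    y           ≤⟨ y≤x+r ⟩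
    x + r       ≡⟨ cong (x +_) eq ⟨
    x + (l + d) ≡⟨ cong (x +_) (+-comm l d) ⟩
    x + (d + l) ≡⟨ +-assoc x d l ⟨
    x + d + l   <⟨ +-monoˡ-< l x+d<c ⟩
    c + l       ≤⟨ Over-height ch ⟩
    y           ∎)
  far (inj₂ n+x≤y+r) = <-irrefl refl (begin-strict
    n + x       ≤⟨ n+x≤y+r ⟩
    y + r       ≡⟨ cong (y +_) eq ⟨
    y + (l + d) ≡⟨ cong (y +_) (+-comm l d) ⟩
    y + (d + l) ≡⟨ +-assoc y d l ⟨
    y + d + l   <⟨ +-monoˡ-< l y+d<n ⟩
    n + l       ≤⟨ +-monoʳ-≤ n (proj₁ (Chain-height ch)) ⟩
    n + x       ∎)
  widen : ∀ {z z' w} → z' < z → z + d < w → z' + suc d < w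
  widen {z} {z'} {w} z'<z z+d<w = begin-strict
    z' + suc d ≡⟨ +-suc z' d ⟩
    suc z' + d ≤⟨ +-monoˡ-≤ d z'<z ⟩
    z + d      <⟨ z+d<w ⟩
    w          ∎
  go : Chain (Over n c (Plus r n A)) l x y → Plus r n A x y → Chain (Over n c A) l x y
  go _                           (inj₂ near) = ⊥-elim (far near)
  go (single (_ , o))            (inj₁ p)    = single (p , o)
  go (extend {l₀} ch₀ u v (_ , o)) (inj₁ p)  = extend
    (strip-near (suc d) (trans (+-suc l₀ d) eq) (widen u x+d<c) (widen v y+d<n) ch₀) u v (p , o)

CrossFree-Plus : ∀ {r n A} → CrossFree r n A → CrossFree r n (Plus r n A)
CrossFree-Plus {r} free {c} {x} {y} ch = free (strip-near 0 (+-identityʳ r)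
  (subst (_< c) (sym (+-identityʳ x)) (proj₁ (proj₂ (last ch))))
  (subst (_< _) (sym (+-identityʳ y)) (proj₂ (proj₂ (proj₂ (last ch))))) ch)

-- Cutting along an edge

-- Here r = `suc q`. The cut edge joins 0 to `1 + α` and leaves `α` and `β` vertices on its two
-- sides; `q < α` and `q < β` say that it is not near. `K` below consists of the edges crossing it,
-- both sides renumbered from 0.
module Cut (q α β : ℕ) (q<α : q < α) (q<β : q < β)
  {B : ℕ → ℕ → Set} (B? : ∀ a b → Dec (B a b))
  (free : CrossFree (suc q) (2 + α + β) B) (edge : B 0 (1 + α)) where

  K : ℕ → ℕ → Set
  K i j = i < α × j < β × B (1 + i) (2 + α + j)

  K? : ∀ i j → Dec (K i j)
  K? i j = (i <? α) ×-dec (j <? β) ×-dec B? (1 + i) (2 + α + j)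

  open Levels K?

  level-bounds : ∀ {l i j} → Level l i j → K i j
  level-bounds (c , _) = last c

  -- The cut edge precedes every edge of `K` in both ends, so it can be put in front of the chain.
  -- Hence only the levels below `q` occur (`no-top`).
  K-chain : ∀ {l i j} → Chain K l i j → Chain (Over (2 + α + β) (1 + α) B) (suc l) (1 + i) (2 + α + j)
  K-chain = go
    where
    over : ∀ {i j} → K i j → Over (2 + α + β) (1 + α) B (1 + i) (2 + α + j)
    over {j = j} (i<α , j<β , b) = b , s<s i<α , ≤-trans (n≤1+n _) (m≤m+n (2 + α) j) , +-monoʳ-< (2 + α) j<β
    go : ∀ {l i j} → Chain K l i j → Chain (Over (2 + α + β) (1 + α) B) (suc l) (1 + i) (2 + α + j)
    go (single p) = extend (single (edge , z<s , ≤-refl , m≤m+n (2 + α) β)) z<s (m≤m+n (2 + α) _) (over p)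
    go (extend c u v p) = extend (go c) (s<s u) (+-monoʳ-< (2 + α) v) (over p)

  no-top : ∀ {i j} → ¬ Chain K q i j
  no-top c = free (K-chain c)

  -- In Left the new vertex of level l is 2 + α + l, in Right it is 1 + l; σ sends the other positive
  -- vertices of Right back to the original numbering.
  Left : ℕ → ℕ → Set
  Left a b = (b ≤ 1 + α × B a b) ⊎
    (0 < a × 2 + α ≤ b × ∃ λ j → j < β × Level (b ∸ (2 + α)) (pred a) j)

  left? : ∀ a b → Dec (Left a b)
  left? a b = ((b ≤? 1 + α) ×-dec B? a b) ⊎-dec
    ((0 <? a) ×-dec (2 + α ≤? b) ×-dec anyUpTo? (λ j → level? (b ∸ (2 + α)) (pred a) j) β)

  σ : ℕ → ℕ
  σ b = 1 + α + (b ∸ (1 + q))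

  Right : ℕ → ℕ → Set
  Right a b = (a ≡ 0 × 2 + q ≤ b × B 0 (σ b)) ⊎
    ((0 < a × a ≤ q × 2 + q ≤ b × ∃ λ i → i < α × Level (pred a) i (b ∸ (2 + q))) ⊎
    (1 + q ≤ a × B (σ a) (σ b)))

  right? : ∀ a b → Dec (Right a b)
  right? a b = ((a ≟ 0) ×-dec (2 + q ≤? b) ×-dec B? 0 (σ b)) ⊎-dec
    (((0 <? a) ×-dec (a ≤? q) ×-dec (2 + q ≤? b) ×-dec anyUpTo? (λ i → level? (pred a) i (b ∸ (2 + q))) α) ⊎-dec
    ((1 + q ≤? a) ×-dec B? (σ a) (σ b)))

  Left-level : ∀ {a l} → Left a (2 + α + l) → ∃ λ i → a ≡ suc i × ∃ λ j → Level l i j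
  Left-level {a} {l} (inj₁ (b≤ , _)) = ⊥-elim (<⇒≱ (m≤m+n (2 + α) l) b≤)
  Left-level {suc i} {l} (inj₂ (_ , _ , j , _ , lev)) = i , refl , j ,
    subst (λ t → Level t i j) (m+n∸m≡n (2 + α) l) lev

  Left-low : ∀ {a b} → b ≤ 1 + α → Left a b → B a b
  Left-low b≤ (inj₁ (_ , e))     = e
  Left-low b≤ (inj₂ (_ , ≤b , _)) = ⊥-elim (<⇒≱ ≤b b≤)

  -- The cut `c` of a chain in `Left` may lie among the new vertices. All left ends are at most `α`,
  -- so lowering the cut to `c ⊓ (1 + α)` keeps them below it, also when right ends are moved to the
  -- other side.
  Left-over : ∀ {c a b} → b ≤ 1 + α → Over (2 + α + q) c Left a b → Over (2 + α + β) (c ⊓ (1 + α)) B a b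
  Left-over {c} {a} {b} b≤ (e , a<c , c≤b , _) =
    Left-low b≤ e , ⊓-pres-m< a<c (<-≤-trans (<-≤-trans a<c c≤b) b≤) ,
    ≤-trans (m⊓n≤m c _) c≤b , s≤s (≤-trans b≤ (s≤s (m≤m+n α β)))

  -- A rerouted edge of level h can be replaced by any level-h edge that starts no earlier: if the predecessor
  -- of that edge on level h' starts before the given h'-edge, the antitone level h' forces the latter to fit.
  left-replace : ∀ {c l x b} → Chain (Over (2 + α + q) c Left) l x b →
    (b ≤ 1 + α → Chain (Over (2 + α + β) (c ⊓ (1 + α)) B) l x b) ×
    (∀ {h i j} → b ≡ 2 + α + h → x ≤ 1 + i → 1 + i < c → Level h i j →
      Chain (Over (2 + α + β) (c ⊓ (1 + α)) B) l (1 + i) (2 + α + j))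
  left-replace {c} ch = low ch , high ch
    where
    over : ∀ {h i j} → 1 + i < c → Level h i j → Over (2 + α + β) (c ⊓ (1 + α)) B (1 + i) (2 + α + j)
    over {j = j} i<c lev with level-bounds lev
    ... | i<α , j<β , e = e , ⊓-pres-m< i<c (s<s i<α) ,
      ≤-trans (m⊓n≤n c _) (≤-trans (n≤1+n _) (m≤m+n (2 + α) j)) , +-monoʳ-< (2 + α) j<β
    low : ∀ {l x b} → Chain (Over (2 + α + q) c Left) l x b →
      b ≤ 1 + α → Chain (Over (2 + α + β) (c ⊓ (1 + α)) B) l x b
    low (single o)        b≤ = single (Left-over b≤ o)
    low (extend ch u v o) b≤ = extend (proj₁ (left-replace ch) (≤-trans (<⇒≤ v) b≤)) u v (Left-over b≤ o)
    high : ∀ {l x b} → Chain (Over (2 + α + q) c Left) l x b → ∀ {h i j} →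
      b ≡ 2 + α + h → x ≤ 1 + i → 1 + i < c → Level h i j →
      Chain (Over (2 + α + β) (c ⊓ (1 + α)) B) l (1 + i) (2 + α + j)
    high (single o) eq x≤ i<c lev = single (over i<c lev)
    high (extend {x' = x'} {y' = b'} ch u v o) {h} {i} {j} eq x≤ i<c lev with b' ≤? 1 + α
    ... | yes b'≤ = extend (proj₁ (left-replace ch) b'≤) (<-≤-trans u x≤)
            (≤-trans (s≤s b'≤) (m≤m+n (2 + α) j)) (over i<c lev)
    ... | no b'≰ with m≤n⇒∃[o]m+o≡n (≰⇒> b'≰)
    ...   | h' , refl with Left-level (proj₁ (last ch))
    ...     | i₀ , refl , j₀ , lev₀ with level-below lev (+-cancelˡ-< (2 + α) h' h (<-≤-trans v (≤-reflexive eq)))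
    ...       | i* , j* , i*<i , j*<j , lev* with i₀ ≤? i*
    ...         | yes i₀≤i* = extend
                  (proj₂ (left-replace ch) refl (s≤s i₀≤i*) (<-trans (s<s i*<i) i<c) lev*)
                  (s<s i*<i) (+-monoʳ-< (2 + α) j*<j) (over i<c lev)
    ...         | no i₀≰i* = extend
                  (proj₂ (left-replace ch) refl ≤-refl (<-trans (<-≤-trans u x≤) i<c) lev₀)
                  (<-≤-trans u x≤)
                  (+-monoʳ-< (2 + α) (≤-<-trans (≮⇒≥ (level-antitone lev* lev₀ (≰⇒> i₀≰i*))) j*<j))
                  (over i<c lev)

  -- A chain ending in an old vertex is transferred as it is; if it ends in a new vertex, its last
  -- edge is replaced by an edge from which it was rerouted.
  left-free : CrossFree (suc q) (2 + α + q) Left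
  left-free {c} {x} {b} ch with b ≤? 1 + α
  ... | yes b≤ = free (proj₁ (left-replace ch) b≤)
  ... | no b≰ with m≤n⇒∃[o]m+o≡n (≰⇒> b≰)
  ...   | h , refl with last ch
  ...     | e , x<c , _ with Left-level e
  ...       | i , refl , j , lev = free (proj₂ (left-replace ch) refl ≤-refl x<c lev)

  data Vertex : ℕ → Set where
    origin : Vertex 0
    new    : ∀ {l} → l < q → Vertex (suc l)
    old    : ∀ {a} → 1 + q ≤ a → Vertex a

  vertex : ∀ a → Vertex a
  vertex zero = origin
  vertex (suc l) with l <? q
  ... | yes l<q = new l<q
  ... | no l≮q  = old (s≤s (≮⇒≥ l≮q))

  σ-mono : ∀ {a b} → a ≤ b → σ a ≤ σ b
  σ-mono a≤b = +-monoʳ-≤ (1 + α) (∸-monoˡ-≤ (1 + q) a≤b)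

  -- Truncated subtraction sends all vertices up to `1 + q` to `1 + α`, so strictness needs the
  -- larger argument beyond `1 + q`.
  σ-mono-< : ∀ {a b} → 1 + q < b → a < b → σ a < σ b
  σ-mono-< {a} {b} q<b a<b with 1 + q ≤? a
  ... | yes q≤a = +-monoʳ-< (1 + α) (∸-monoˡ-< a<b q≤a)
  ... | no q≰a = +-monoʳ-< (1 + α) (≤-<-trans (≤-reflexive (m≤n⇒m∸n≡0 (<⇒≤ (≰⇒> q≰a)))) (m<n⇒0<n∸m q<b))

  σ-old : ∀ a → σ (1 + q + a) ≡ 1 + α + a
  σ-old a = cong (1 + α +_) (m+n∸m≡n (1 + q) a)

  σ-new : ∀ j → σ (2 + q + j) ≡ 2 + α + j
  σ-new j = begin
    σ (2 + q + j)       ≡⟨ cong (λ t → σ (suc t)) (+-suc q j) ⟨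
    σ (1 + q + suc j)   ≡⟨ σ-old (suc j) ⟩
    1 + α + suc j       ≡⟨ cong suc (+-suc α j) ⟩
    2 + α + j           ∎
    where open ≡-Reasoning

  σ-bound : ∀ {b} → b < 2 + q + β → σ b < 2 + α + β
  σ-bound {b} b< = subst (σ b <_) (σ-new β) (σ-mono-< (m≤m+n (2 + q) β) b<)

  Right-level : ∀ {l b} → l < q → Right (suc l) b → ∃ λ i → ∃ λ j → b ≡ 2 + q + j × Level l i j
  Right-level l<q (inj₁ (() , _))
  Right-level {l} {b} l<q (inj₂ (inj₁ (_ , _ , q≤b , i , _ , lev))) =
    i , b ∸ (2 + q) , sym (m+[n∸m]≡n q≤b) , lev
  Right-level l<q (inj₂ (inj₂ (q≤l , _))) = ⊥-elim (<⇒≱ l<q (s≤s⁻¹ q≤l))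

  Right-old : ∀ {a b} → 1 + q ≤ a → Right a b → B (σ a) (σ b)
  Right-old q≤a (inj₁ (refl , _)) = ⊥-elim (<⇒≱ z<s q≤a)
  Right-old q≤a (inj₂ (inj₁ (_ , a≤q , _))) = ⊥-elim (<⇒≱ q≤a a≤q)
  Right-old q≤a (inj₂ (inj₂ (_ , e))) = e

  Right-origin : ∀ {b} → Right 0 b → 2 + q ≤ b × B 0 (σ b)
  Right-origin (inj₁ (_ , q≤b , e)) = q≤b , e
  Right-origin (inj₂ (inj₁ (() , _)))
  Right-origin (inj₂ (inj₂ (() , _)))

  -- The mirror image of `left-replace`. New vertices are now left ends, and a rerouted edge may be
  -- replaced by any edge of its level that ends no earlier. Left ends increase along the chain, so
  -- it meets the origin first, then new vertices, then old ones.
  right-replace : ∀ {c l a b} → Chain (Over (2 + q + β) c Right) l a b →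
    (a ≡ 0 → Chain (Over (2 + α + β) (σ c) B) l 0 (σ b)) ×
    (∀ {h i j} → a ≡ suc h → h < q → b ≤ 2 + q + j → Level h i j →
      Chain (Over (2 + α + β) (σ c) B) l (1 + i) (2 + α + j)) ×
    (1 + q ≤ a → Chain (Over (2 + α + β) (σ c) B) l (σ a) (σ b))
  right-replace {c} ch = first ch , middle ch , upper ch
    where
    Goal : ℕ → ℕ → ℕ → Set
    Goal = Chain (Over (2 + α + β) (σ c) B)
    first : ∀ {l a b} → Chain (Over (2 + q + β) c Right) l a b → a ≡ 0 → Goal l 0 (σ b)
    first (single (e , _ , c≤b , b<n)) refl = single (proj₂ (Right-origin e) , z<s , σ-mono c≤b , σ-bound b<n)
    first (extend _ () _ _) refl
    middle : ∀ {l a b} → Chain (Over (2 + q + β) c Right) l a b → ∀ {h i j} →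
      a ≡ suc h → h < q → b ≤ 2 + q + j → Level h i j → Goal l (1 + i) (2 + α + j)
    middle {b = b} ch {h} {i} {j} refl h<q b≤ lev = go ch
      where
      b<σ : ∀ {b'} → b' < b → σ b' < 2 + α + j
      b<σ {b'} b'<b = subst (σ b' <_) (σ-new j) (σ-mono-< (m≤m+n (2 + q) j) (<-≤-trans b'<b b≤))
      over : c ≤ b → Over (2 + α + β) (σ c) B (1 + i) (2 + α + j)
      over c≤b with level-bounds lev
      ... | i<α , j<β , e = e , ≤-trans (s<s i<α) (m≤m+n (1 + α) _) ,
        subst (σ c ≤_) (σ-new j) (σ-mono (≤-trans c≤b b≤)) , +-monoʳ-< (2 + α) j<β
      go : ∀ {l} → Chain (Over (2 + q + β) c Right) l (suc h) b → Goal l (1 + i) (2 + α + j)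
      go (single (_ , _ , c≤b , _)) = single (over c≤b)
      go (extend {x' = a'} {y' = b'} ch' u v (_ , _ , c≤b , _)) with vertex a'
      ... | origin  = extend (proj₁ (right-replace ch') refl) z<s (b<σ v) (over c≤b)
      ... | old q≤a' = ⊥-elim (<⇒≱ h<q (≤-trans (n≤1+n q) (≤-trans q≤a' (s≤s⁻¹ u))))
      ... | new {h'} h'<q with Right-level h'<q (proj₁ (last ch')) | level-below lev (s<s⁻¹ u)
      ...   | i₀ , j₀ , refl , lev₀ | i* , j* , i*<i , j*<j , lev* with j₀ ≤? j*
      ...     | yes j₀≤j* = extend
                (proj₁ (proj₂ (right-replace ch')) refl h'<q (+-monoʳ-≤ (2 + q) j₀≤j*) lev*)
                (s<s i*<i) (+-monoʳ-< (2 + α) j*<j) (over c≤b)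
      ...     | no j₀≰j* = extend
                (proj₁ (proj₂ (right-replace ch')) refl h'<q ≤-refl lev₀)
                (s<s (≤-<-trans (≮⇒≥ λ i*<i₀ → level-antitone lev* lev₀ i*<i₀ (≰⇒> j₀≰j*)) i*<i))
                (subst (_< 2 + α + j) (σ-new j₀) (b<σ v)) (over c≤b)
    upper : ∀ {l a b} → Chain (Over (2 + q + β) c Right) l a b → 1 + q ≤ a → Goal l (σ a) (σ b)
    upper {a = a} {b} ch q≤a = go ch
      where
      q<b : Over (2 + q + β) c Right a b → 1 + q < b
      q<b (_ , a<c , c≤b , _) = ≤-<-trans q≤a (<-≤-trans a<c c≤b)
      over : Over (2 + q + β) c Right a b → Over (2 + α + β) (σ c) B (σ a) (σ b)
      over (e , a<c , c≤b , b<n) = Right-old q≤a e , σ-mono-< (≤-<-trans q≤a a<c) a<c , σ-mono c≤b , σ-bound b<n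
      go : ∀ {l} → Chain (Over (2 + q + β) c Right) l a b → Goal l (σ a) (σ b)
      go (single o) = single (over o)
      go (extend {x' = a'} {y' = b'} ch' u v o) with vertex a'
      ... | origin = extend (proj₁ (right-replace ch') refl) z<s (σ-mono-< (q<b o) v) (over o)
      ... | old q≤a' = extend (proj₂ (proj₂ (right-replace ch')) q≤a') (σ-mono-< (≤-<-trans q≤a' u) u)
              (σ-mono-< (q<b o) v) (over o)
      ... | new {h'} h'<q with Right-level h'<q (proj₁ (last ch'))
      ...   | i₀ , j₀ , refl , lev₀ = extend
              (proj₁ (proj₂ (right-replace ch')) refl h'<q ≤-refl lev₀)
              (≤-trans (s<s (proj₁ (level-bounds lev₀))) (m≤m+n (1 + α) _))
              (subst (_< σ b) (σ-new j₀) (σ-mono-< (q<b o) v)) (over o)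

  right-free : CrossFree (suc q) (2 + q + β) Right
  right-free {c} {a} {b} ch with vertex a
  ... | origin = free (proj₁ (right-replace ch) refl)
  ... | old q≤a = free (proj₂ (proj₂ (right-replace ch)) q≤a)
  ... | new h<q with Right-level h<q (proj₁ (last ch))
  ...   | i , j , refl , lev = free (proj₁ (proj₂ (right-replace ch)) refl h<q ≤-refl lev)

  -- Counting the edges of the two pieces

  levelsOf : ℕ → ℕ
  levelsOf l = rectCount (λ j i → level? l i j) β α

  -- The vertices joined to the new vertex of level `l`; those with `i ≤ l` are joined to it by near
  -- edges in any case.
  leftHit? : ∀ l i → Dec (i ≤ l ⊎ (∃ λ j → j < β × Level l i j))
  leftHit? l i = (i ≤? l) ⊎-dec colHit? (λ j i → level? l i j) β i

  rightHit? : ∀ l j → Dec (j ≤ l ⊎ (∃ λ i → i < α × Level l i j))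
  rightHit? l j = (j ≤? l) ⊎-dec rowHit? (λ j i → level? l i j) α j

  -- A nonempty level has one edge less than endpoints, or fewer still. Its edges have both ends at
  -- least `l` (`Chain-height`), so the near edges to the first `l` vertices on each side add `2 l`.
  -- For an empty level the near edges alone give `2 (l + 1)`.
  level-count : ∀ l → l < q → levelsOf l + (1 + (l + l)) ≤ count (leftHit? l) α + count (rightHit? l) β
  level-count l l<q with levelsOf l in eq
  ... | zero = ≤-trans (≤-trans (n≤1+n _) (≤-reflexive (sym (cong suc (+-suc l l)))))
    (+-mono-≤ (pad-empty α (<-trans l<q q<α)) (pad-empty β (<-trans l<q q<β)))
    where
    pad-empty : ∀ {Q : ℕ → Set} {Q? : ∀ i → Dec (Q i)} m → l < m →
      suc l ≤ count (λ i → (i ≤? l) ⊎-dec Q? i) m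
    pad-empty {Q? = Q?} m l<m = ≤-trans
      (count-all (λ i → (i ≤? l) ⊎-dec Q? i) (suc l) λ i i≤l → inj₁ (s≤s⁻¹ i≤l)) (sumTo-grow _ l<m)
  ... | suc s = begin
    suc s + (1 + (l + l))     ≡⟨ regroup (suc s) l ⟩
    (suc s + 1) + (l + l)     ≡⟨ cong (λ t → (t + 1) + (l + l)) eq ⟨
    (levelsOf l + 1) + (l + l)
      ≤⟨ +-monoˡ-≤ (l + l) (antitone-count (λ j i → level? l i j) β α
           (λ e e' u v → level-antitone e e' v u) (subst (1 ≤_) (sym eq) (s≤s z≤n))) ⟩
    (Y + X) + (l + l)         ≡⟨ regroup' Y X l ⟩
    (l + X) + (l + Y)         ≤⟨ +-mono-≤
      (pad (colHit? (λ j i → level? l i j) β) α (<⇒≤ (<-trans l<q q<α))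
        λ i (j , _ , lev) → proj₁ (Chain-height (proj₁ lev)))
      (pad (rowHit? (λ j i → level? l i j) α) β (<⇒≤ (<-trans l<q q<β))
        λ j (i , _ , lev) → proj₂ (Chain-height (proj₁ lev))) ⟩
    count (leftHit? l) α + count (rightHit? l) β ∎
    where
    open ≤-Reasoning
    X = count (colHit? (λ j i → level? l i j) β) α
    Y = count (rowHit? (λ j i → level? l i j) α) β
    regroup : ∀ s l → s + (1 + (l + l)) ≡ (s + 1) + (l + l)
    regroup = solve-∀
    regroup' : ∀ y x l → (y + x) + (l + l) ≡ (l + x) + (l + y)
    regroup' = solve-∀
    pad : ∀ {Q : ℕ → Set} (Q? : ∀ i → Dec (Q i)) m → l ≤ m → (∀ i → Q i → l ≤ i) →
      l + count Q? m ≤ count (λ i → (i ≤? l) ⊎-dec Q? i) m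
    pad Q? m l≤m above = ≤-trans
      (+-monoˡ-≤ (count Q? m) (≤-trans (count-all (_<? l) l (λ i i<l → i<l)) (sumTo-grow _ l≤m)))
      (count-pack (_<? l) Q? (λ i → (i ≤? l) ⊎-dec Q? i) m (λ i _ i<l → inj₁ (<⇒≤ i<l)) (λ i _ → inj₂)
        (λ i _ i<l qi → <⇒≱ i<l (above i qi)))

  through : ℕ
  through = sumTo β (λ j → sumTo α (λ i → ind (B? (1 + i) (2 + α + j))))

  -- Levels are peeled off one at a time: an edge ending a chain of index `l` has level `l` or ends
  -- a chain of index `l + 1`, and `no-top` leaves nothing at index `q`.
  through-count : through ≤ sumTo q levelsOf
  through-count = begin
    through                       ≤⟨ sumTo-mono β (λ j j<β → sumTo-mono α λ i i<α →
                                       ind-mono (B? _ _) (chain? K? 0 i j) λ e → single (i<α , j<β , e)) ⟩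
    chains 0                      ≤⟨ telescope₀ ⟩
    sumTo q levelsOf + chains q   ≡⟨ cong (sumTo q levelsOf +_) top ⟩
    sumTo q levelsOf + 0          ≡⟨ +-identityʳ _ ⟩
    sumTo q levelsOf              ∎
    where
    open ≤-Reasoning
    chains : ℕ → ℕ
    chains l = rectCount (λ j i → chain? K? l i j) β α
    peel : ∀ l → chains l ≤ levelsOf l + chains (suc l)
    peel l = ≤-trans
      (sumTo-mono β λ j _ → count-cover (λ i → chain? K? l i j) (λ i → level? l i j) (λ i → chain? K? (suc l) i j) α
        λ i _ c → split i j c)
      (≤-reflexive (sumTo-+ β _ _))
      where
      split : ∀ i j → Chain K l i j → Level l i j ⊎ Chain K (suc l) i j
      split i j c with chain? K? (suc l) i j
      ... | yes c' = inj₂ c'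
      ... | no ¬c' = inj₁ (c , ¬c')
    telescope : ∀ d l → chains l ≤ sumTo d (λ h → levelsOf (h + l)) + chains (d + l)
    telescope zero    l = ≤-refl
    telescope (suc d) l = begin
      chains l ≤⟨ peel l ⟩
      levelsOf l + chains (suc l) ≤⟨ +-monoʳ-≤ (levelsOf l) (telescope d (suc l)) ⟩
      levelsOf l + (sumTo d (λ h → levelsOf (h + suc l)) + chains (d + suc l))
        ≡⟨ cong (levelsOf l +_) (cong₂ _+_ (sumTo-cong d λ h → cong levelsOf (+-suc h l)) (cong chains (+-suc d l))) ⟩
      levelsOf l + (sumTo d (λ h → levelsOf (suc h + l)) + chains (suc d + l)) ≡⟨ +-assoc (levelsOf l) _ _ ⟨
      sumTo (suc d) (λ h → levelsOf (h + l)) + chains (suc d + l) ∎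
    top : chains q ≡ 0
    top = n≤0⇒n≡0 (≤-trans (sumTo-mono β λ j _ → ≤-reflexive (count-none (λ i → chain? K? q i j) α λ i _ → no-top))
      (≤-reflexive (sumTo-zero β)))
    telescope₀ : chains 0 ≤ sumTo q levelsOf + chains q
    telescope₀ = subst (λ t → chains 0 ≤ t) (cong₂ _+_ (sumTo-cong q λ h → cong levelsOf (+-identityʳ h))
      (cong chains (+-identityʳ q))) (telescope q 0)

  leftPlus? : ∀ a b → Dec (Plus (suc q) (2 + α + q) Left a b)
  leftPlus? = plus? (suc q) (2 + α + q) left?

  rightPlus? : ∀ a b → Dec (Plus (suc q) (2 + q + β) Right a b)
  rightPlus? = plus? (suc q) (2 + q + β) right?

  -- The gain: `q * q` is the sum of the `1 + 2 l` over the levels; `q` counts the near edges from 0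
  -- to the new vertices of `Left`; and `suc q * suc q` is `tri (1 + q)` for the complete graph on
  -- `1 + α` and the new vertices of `Left`, plus `tri (2 + q)` for the one on the first `2 + q`
  -- vertices of `Right`.
  cut-count : pairs B? (2 + α + β) + (q + suc q * suc q + q * q) ≤
    pairs leftPlus? (2 + α + q) + pairs rightPlus? (2 + q + β)
  cut-count = begin
    pairs B? (2 + α + β) + (q + suc q * suc q + q * q)
      ≡⟨ cong₂ (λ s t → s + (q + t + q * q)) (pairs-blocks B? α β) tri-square ⟩
    I + (Z + (through + O)) + (q + (tri (1 + q) + tri (2 + q)) + q * q)
      ≡⟨ regroup I Z through O q (tri (1 + q)) (tri (2 + q)) (q * q) ⟩
    (through + q * q) + (I + (Z + (O + (q + (tri (1 + q) + tri (2 + q))))))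
      ≤⟨ +-mono-≤ middle-count (+-mono-≤ I≤ (+-mono-≤ Z≤ (+-mono-≤ O≤ (+-mono-≤ q≤ (+-mono-≤ new≤ fan≤))))) ⟩
    (M₁ + M₂) + (I₁ + (Z₂ + (O₂ + (Z₁ + (O₁ + I₂)))))
      ≡⟨ regroup' M₁ M₂ I₁ Z₂ O₂ Z₁ O₁ I₂ ⟩
    (I₁ + (Z₁ + (M₁ + O₁))) + (I₂ + (Z₂ + (M₂ + O₂)))
      ≡⟨ cong₂ _+_ (pairs-blocks leftPlus? α q) (pairs-blocks rightPlus? q β) ⟨
    pairs leftPlus? (2 + α + q) + pairs rightPlus? (2 + q + β) ∎
    where
    open ≤-Reasoning
    I = pairs B? (2 + α)
    Z = sumTo β (λ j → ind (B? 0 (2 + α + j)))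
    O = pairs (λ a b → B? (1 + α + a) (1 + α + b)) (1 + β)
    I₁ = pairs leftPlus? (2 + α)
    Z₁ = sumTo q (λ j → ind (leftPlus? 0 (2 + α + j)))
    M₁ = sumTo q (λ j → sumTo α (λ i → ind (leftPlus? (1 + i) (2 + α + j))))
    O₁ = pairs (λ a b → leftPlus? (1 + α + a) (1 + α + b)) (1 + q)
    I₂ = pairs rightPlus? (2 + q)
    Z₂ = sumTo β (λ j → ind (rightPlus? 0 (2 + q + j)))
    M₂ = sumTo β (λ j → sumTo q (λ i → ind (rightPlus? (1 + i) (2 + q + j))))
    O₂ = pairs (λ a b → rightPlus? (1 + q + a) (1 + q + b)) (1 + β)
    tri-square : suc q * suc q ≡ tri (1 + q) + tri (2 + q)
    tri-square = sym (trans (shuffle (suc q) (tri (1 + q))) (tri-double (suc q)))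
      where
      shuffle : ∀ s t → t + (s + t) ≡ t + t + s
      shuffle = solve-∀
    regroup : ∀ i z m o q s t u → i + (z + (m + o)) + (q + (s + t) + u) ≡ (m + u) + (i + (z + (o + (q + (s + t)))))
    regroup = solve-∀
    regroup' : ∀ m₁ m₂ i₁ z₂ o₂ z₁ o₁ i₂ → (m₁ + m₂) + (i₁ + (z₂ + (o₂ + (z₁ + (o₁ + i₂))))) ≡
      (i₁ + (z₁ + (m₁ + o₁))) + (i₂ + (z₂ + (m₂ + o₂)))
    regroup' = solve-∀
    I≤ : I ≤ I₁
    I≤ = pairs-mono B? leftPlus? (2 + α) λ a b _ b< e → inj₁ (inj₁ (s≤s⁻¹ b< , e))
    Z≤ : Z ≤ Z₂
    Z≤ = sumTo-mono β λ j _ → ind-mono (B? _ _) (rightPlus? _ _) λ e →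
      inj₁ (inj₁ (refl , m≤m+n (2 + q) j , subst (B 0) (sym (σ-new j)) e))
    O≤ : O ≤ O₂
    O≤ = pairs-mono (λ a b → B? (1 + α + a) (1 + α + b)) (λ a b → rightPlus? (1 + q + a) (1 + q + b)) (1 + β)
      λ a b _ _ e → inj₁ (inj₂ (inj₂ (m≤m+n (1 + q) a , subst₂ B (sym (σ-old a)) (sym (σ-old b)) e)))
    q≤ : q ≤ Z₁
    q≤ = count-all (λ j → leftPlus? 0 (2 + α + j)) q λ j _ → inj₂ (inj₂ (begin
      2 + α + q + 0       ≡⟨ +-identityʳ _ ⟩
      2 + α + q           ≤⟨ +-mono-≤ (m≤m+n (2 + α) j) (n≤1+n q) ⟩
      2 + α + j + suc q   ∎))
    new≤ : tri (1 + q) ≤ O₁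
    new≤ = pairs-complete (λ a b → leftPlus? (1 + α + a) (1 + α + b)) (1 + q) λ a b _ b< → inj₂ (inj₁ (begin
      1 + α + b           ≤⟨ +-mono-≤ (m≤m+n (1 + α) a) (<⇒≤ b<) ⟩
      1 + α + a + suc q   ∎))
    fan≤ : tri (2 + q) ≤ I₂
    fan≤ = pairs-complete rightPlus? (2 + q) λ a b _ b< → inj₂ (inj₁ (≤-trans (s≤s⁻¹ b<) (m≤n+m (suc q) a)))
    left-middle : sumTo q (λ l → count (leftHit? l) α) ≤ M₁
    left-middle = sumTo-mono q λ l _ → count-mono (leftHit? l) (λ i → leftPlus? (1 + i) (2 + α + l)) α (step l)
      where
      rearrange : ∀ s q i → s + q + (1 + i) ≡ s + i + (1 + q)
      rearrange = solve-∀
      step : ∀ l i → i < α → i ≤ l ⊎ (∃ λ j → j < β × Level l i j) →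
        Plus (suc q) (2 + α + q) Left (1 + i) (2 + α + l)
      step l i _ (inj₁ i≤l) = inj₂ (inj₂ (≤-trans (≤-reflexive (rearrange (2 + α) q i))
        (+-monoˡ-≤ (suc q) (+-monoʳ-≤ (2 + α) i≤l))))
      step l i _ (inj₂ (j , j<β , lev)) = inj₁ (inj₂ (z<s , m≤m+n (2 + α) l , j , j<β ,
        subst (λ t → Level t i j) (sym (m+n∸m≡n (2 + α) l)) lev))
    right-middle : sumTo q (λ l → count (rightHit? l) β) ≤ M₂
    right-middle = ≤-trans
      (sumTo-mono q λ l l<q → count-mono (rightHit? l) (λ j → rightPlus? (1 + l) (2 + q + j)) β (step l l<q))
      (≤-reflexive (sumTo-swap q β _))
      where
      rearrange : ∀ q l → 2 + q + l ≡ 1 + l + (1 + q)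
      rearrange = solve-∀
      step : ∀ l → l < q → ∀ j → j < β → j ≤ l ⊎ (∃ λ i → i < α × Level l i j) →
        Plus (suc q) (2 + q + β) Right (1 + l) (2 + q + j)
      step l l<q j _ (inj₁ j≤l) = inj₂ (inj₁ (≤-trans (+-monoʳ-≤ (2 + q) j≤l) (≤-reflexive (rearrange q l))))
      step l l<q j _ (inj₂ (i , i<α , lev)) = inj₁ (inj₂ (inj₁ (z<s , l<q , m≤m+n (2 + q) j , i , i<α ,
        subst (Level l i) (sym (m+n∸m≡n (2 + q) j)) lev)))
    odd-sum : ∀ n → sumTo n (λ l → 1 + (l + l)) ≡ n * n
    odd-sum zero    = refl
    odd-sum (suc n) = trans (sumTo-last n _) (trans (cong (_+ (1 + (n + n))) (odd-sum n)) (square n))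
      where
      square : ∀ n → n * n + (1 + (n + n)) ≡ suc n * suc n
      square = solve-∀
    middle-count : through + q * q ≤ M₁ + M₂
    middle-count = begin
      through + q * q           ≤⟨ +-monoˡ-≤ (q * q) through-count ⟩
      sumTo q levelsOf + q * q  ≡⟨ cong (sumTo q levelsOf +_) (odd-sum q) ⟨
      sumTo q levelsOf + sumTo q (λ l → 1 + (l + l)) ≡⟨ sumTo-+ q _ _ ⟨
      sumTo q (λ l → levelsOf l + (1 + (l + l))) ≤⟨ sumTo-mono q level-count ⟩
      sumTo q (λ l → count (leftHit? l) α + count (rightHit? l) β) ≡⟨ sumTo-+ q _ _ ⟩
      sumTo q (λ l → count (leftHit? l) α) + sumTo q (λ l → count (rightHit? l) β)
        ≤⟨ +-mono-≤ left-middle right-middle ⟩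
      M₁ + M₂ ∎

-- The Capoyleas-Pach bound

-- Subtraction-free, with `r * (1 + 2 * r)` for C(2r+1,2). Near pairs are included in the count so
-- that the induction can use them in the pieces.
CrossBound : ℕ → ℕ → Set₁
CrossBound r n = ∀ {A : ℕ → ℕ → Set} (A? : ∀ a b → Dec (A a b)) → CrossFree r n A →
  pairs (plus? r n A?) n + r * (1 + 2 * r) ≤ 2 * r * n

Far : ℕ → ℕ → (ℕ → ℕ → Set) → ℕ → ℕ → Set
Far r n A a b = A a b × ¬ Near r n a b

far? : ∀ r n {A : ℕ → ℕ → Set} → (∀ a b → Dec (A a b)) → ∀ a b → Dec (Far r n A a b)
far? r n A? a b = A? a b ×-dec ¬? (near? r n a b)

pairs-plus≤ : ∀ r n {A : ℕ → ℕ → Set} (A? : ∀ a b → Dec (A a b)) →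
  pairs (plus? r n A?) n ≤ pairs (far? r n A?) n + pairs (near? r n) n
pairs-plus≤ r n {A} A? = pairs-cover (plus? r n A?) (far? r n A?) (near? r n) n split
  where
  split : ∀ a b → a < b → b < n → Plus r n A a b → Far r n A a b ⊎ Near r n a b
  split a b _ _ e with near? r n a b | e
  ... | yes near | _         = inj₂ near
  ... | no _     | inj₂ near = inj₂ near
  ... | no far   | inj₁ p    = inj₁ (p , far)

pairs-plus≥ : ∀ r n {A : ℕ → ℕ → Set} (A? : ∀ a b → Dec (A a b)) →
  pairs (far? r n A?) n + pairs (near? r n) n ≤ pairs (plus? r n A?) n
pairs-plus≥ r n A? = pairs-pack (far? r n A?) (near? r n) (plus? r n A?) n
  (λ _ _ _ _ e → inj₁ (proj₁ e)) (λ _ _ _ _ → inj₂) (λ _ _ _ _ (_ , far) near → far near)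

-- The two pieces have n + 2r vertices together, which costs 4r² in the sum of their bounds, while
-- C(2r+1,2) is subtracted once more than needed. The difference 4r² - C(2r+1,2) = 2r² - r is
-- exactly the gain in `cut-count`.
cut-bound : ∀ q n → (∀ {m} → m < n → 1 + 2 * suc q ≤ m → CrossBound (suc q) m) →
  ∀ {A : ℕ → ℕ → Set} (A? : ∀ a b → Dec (A a b)) → CrossFree (suc q) n A →
  ∀ {b} → b < n → Far (suc q) n A 0 b → pairs (plus? (suc q) n A?) n + suc q * (1 + 2 * suc q) ≤ 2 * suc q * n
cut-bound q n rec {A} A? free {zero} b<n (_ , far) = ⊥-elim (far (inj₁ z≤n))
cut-bound q n rec {A} A? free {suc α} b<n (e , far) with m≤n⇒∃[o]m+o≡n b<n
... | β , refl = +-cancelʳ-≤ (4 * (suc q * suc q)) _ _ (begin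
  T + suc q * (1 + 2 * suc q) + 4 * (suc q * suc q)
    ≡⟨ before T q ⟩
  T + (q + suc q * suc q + q * q) + 2 * (suc q * (1 + 2 * suc q))
    ≤⟨ +-monoˡ-≤ _ cut-count ⟩
  T₁ + T₂ + 2 * (suc q * (1 + 2 * suc q))
    ≡⟨ middle T₁ T₂ q ⟩
  (T₁ + suc q * (1 + 2 * suc q)) + (T₂ + suc q * (1 + 2 * suc q))
    ≤⟨ +-mono-≤ (rec (+-monoʳ-< (2 + α) q<β) (size q α q<α) left? left-free)
                (rec (+-monoˡ-< β (+-monoʳ-< 2 q<α))
                  (≤-trans (size q β q<β) (≤-reflexive (cong (2 +_) (+-comm β q)))) right? right-free) ⟩
  2 * suc q * (2 + α + q) + 2 * suc q * (2 + q + β)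
    ≡⟨ after q α β ⟩
  2 * suc q * (2 + α + β) + 4 * (suc q * suc q) ∎)
  where
  open ≤-Reasoning
  q<α : q < α
  q<α = s≤s⁻¹ (≰⇒> λ α≤q → far (inj₁ α≤q))
  q<β : q < β
  q<β = s<s⁻¹ (+-cancelˡ-< (2 + α) (suc q) (suc β) (begin-strict
    2 + α + suc q ≡⟨ cong suc (+-comm (suc α) (suc q)) ⟩
    suc (suc q + suc α) ≤⟨ s≤s (≤-reflexive (+-comm (suc q) (suc α))) ⟩
    suc (suc α + suc q) ≤⟨ ≰⇒> (λ le → far (inj₂ le)) ⟩
    2 + α + β + 0 ≡⟨ +-identityʳ _ ⟩
    2 + α + β     <⟨ +-monoʳ-< (2 + α) (n<1+n β) ⟩
    2 + α + suc β ∎))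
  open Cut q α β q<α q<β (plus? (suc q) (2 + α + β) A?) (CrossFree-Plus free) (inj₁ e)
  T = pairs (plus? (suc q) (2 + α + β) A?) (2 + α + β)
  T₁ = pairs leftPlus? (2 + α + q)
  T₂ = pairs rightPlus? (2 + q + β)
  size : ∀ q α → q < α → 1 + 2 * suc q ≤ 2 + α + q
  size q α q<α = begin
    1 + 2 * suc q     ≡⟨ double q ⟩
    2 + suc q + q     ≤⟨ +-monoˡ-≤ q (+-monoʳ-≤ 2 q<α) ⟩
    2 + α + q         ∎
    where
    double : ∀ q → 1 + 2 * suc q ≡ 2 + suc q + q
    double = solve-∀
  before : ∀ t q → t + suc q * (1 + 2 * suc q) + 4 * (suc q * suc q) ≡
    t + (q + suc q * suc q + q * q) + 2 * (suc q * (1 + 2 * suc q))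
  before = solve-∀
  middle : ∀ t₁ t₂ q → t₁ + t₂ + 2 * (suc q * (1 + 2 * suc q)) ≡
    (t₁ + suc q * (1 + 2 * suc q)) + (t₂ + suc q * (1 + 2 * suc q))
  middle = solve-∀
  after : ∀ q α β → 2 * suc q * (2 + α + q) + 2 * suc q * (2 + q + β) ≡
    2 * suc q * (2 + α + β) + 4 * (suc q * suc q)
  after = solve-∀

tri-odd : ∀ s → tri (1 + 2 * s) ≡ s * (1 + 2 * s)
tri-odd s = *-cancelˡ-≡ _ _ 2 (+-cancelʳ-≡ n _ _ (begin
  2 * tri n + n         ≡⟨ cong (λ t → tri n + t + n) (+-identityʳ (tri n)) ⟩
  tri n + tri n + n     ≡⟨ tri-double n ⟩
  n * n                 ≡⟨ expand s ⟩
  2 * (s * n) + n       ∎))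
  where
  open ≡-Reasoning
  n = 1 + 2 * s
  expand : ∀ s → (1 + 2 * s) * (1 + 2 * s) ≡ 2 * (s * (1 + 2 * s)) + (1 + 2 * s)
  expand = solve-∀

-- Adding one edge that is not near creates no crossing, so the cut applies to it.
near-bound : ∀ q n → (∀ {m} → m < n → 1 + 2 * suc q ≤ m → CrossBound (suc q) m) → 1 + 2 * suc q ≤ n →
  pairs (near? (suc q) n) n + suc q * (1 + 2 * suc q) ≤ 2 * suc q * n
near-bound q n rec r≤n with m≤n⇒m<n∨m≡n r≤n
-- On n = 2r + 1 vertices the bound is that of the complete graph, as C(n,2) = r n.
... | inj₂ refl = begin
  pairs (near? (suc q) n) n + suc q * n  ≤⟨ +-monoˡ-≤ _ (pairs-≤tri (near? (suc q) n) n) ⟩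
  tri n + suc q * n                      ≡⟨ cong (_+ suc q * n) (tri-odd (suc q)) ⟩
  suc q * n + suc q * n                  ≡⟨ double (suc q) n ⟩
  2 * suc q * n                          ∎
  where
  open ≤-Reasoning
  double : ∀ s n → s * n + s * n ≡ 2 * s * n
  double = solve-∀
... | inj₁ r<n = ≤-trans
  (+-monoˡ-≤ _ (pairs-mono (near? (suc q) n) (plus? (suc q) n lone?) n λ _ _ _ _ → inj₂))
  (cut-bound q n rec lone? lone-free (≤-trans (≤-trans (s≤s (m≤m+n (2 + q) (suc q))) (≤-reflexive (size q))) r<n)
    ((refl , refl) , far))
  where
  -- `2 + q` = r + 1 is the least length that is not near; as n > 2r + 1, the other way round is
  -- longer than r too.
  Lone : ℕ → ℕ → Set
  Lone a b = a ≡ 0 × b ≡ 2 + q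
  lone? : ∀ a b → Dec (Lone a b)
  lone? a b = (a ≟ 0) ×-dec (b ≟ 2 + q)
  lone-free : CrossFree (suc q) n Lone
  lone-free (extend _ () _ ((refl , _) , _))
  size : ∀ q → suc (2 + q + suc q) ≡ suc (1 + 2 * suc q)
  size = solve-∀
  far : ¬ Near (suc q) n 0 (2 + q)
  far (inj₁ le) = <-irrefl refl le
  far (inj₂ le) = <-irrefl refl (<-≤-trans r<n (≤-trans (≤-reflexive (sym (+-identityʳ n)))
    (≤-trans le (≤-reflexive (suc-injective (size q))))))

-- Vertices below the first edge that is not near are isolated among such edges, so they can be moved
-- to the end; t bounds the right ends and makes the shifting terminate.
shift-bound : ∀ q n → (∀ {m} → m < n → 1 + 2 * suc q ≤ m → CrossBound (suc q) m) → 1 + 2 * suc q ≤ n →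
  ∀ t {A : ℕ → ℕ → Set} (A? : ∀ a b → Dec (A a b)) → CrossFree (suc q) n A →
  (∀ {a b} → b < n → Far (suc q) n A a b → b < t) →
  pairs (plus? (suc q) n A?) n + suc q * (1 + 2 * suc q) ≤ 2 * suc q * n
shift-bound q n rec r≤n zero {A} A? free low = ≤-trans
  (+-monoˡ-≤ _ (pairs-mono (plus? (suc q) n A?) (near? (suc q) n) n only-near)) (near-bound q n rec r≤n)
  where
  only-near : ∀ a b → a < b → b < n → Plus (suc q) n A a b → Near (suc q) n a b
  only-near a b _ b<n e with near? (suc q) n a b | e
  ... | yes near | _         = near
  ... | no _     | inj₂ near = near
  ... | no far   | inj₁ p with low b<n (p , far)
  ...   | ()
shift-bound q zero rec () (suc t)
shift-bound q n@(suc n₀) rec r≤n (suc t) {A} A? free low with anyUpTo? (far? (suc q) n A? 0) n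
... | yes (b , b<n , e) = cut-bound q n rec A? free b<n e
... | no none = ≤-trans (+-monoˡ-≤ _ no-loss) (shift-bound q n rec r≤n t A'? free' low')
  where
  -- Vertex 0 carries only near edges, and nearness is invariant under the shift, so `Plus` restores
  -- what is lost. The guard keeps the last vertex from becoming a right end.
  A' : ℕ → ℕ → Set
  A' a b = suc b < n × A (suc a) (suc b)
  A'? : ∀ a b → Dec (A' a b)
  A'? a b = (suc b <? n) ×-dec A? (suc a) (suc b)
  free' : CrossFree (suc q) n A'
  free' ch = free (Chain-map suc suc s<s s<s (λ ((b<n , e) , a<c , c≤b , _) → e , s<s a<c , s≤s c≤b , b<n) ch)
  near-suc : ∀ {a b} → Near (suc q) n (suc a) (suc b) → Near (suc q) n a b
  near-suc (inj₁ le) = inj₁ (s≤s⁻¹ le)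
  near-suc {a} (inj₂ le) = inj₂ (s≤s⁻¹ (≤-trans (≤-reflexive (sym (+-suc n a))) le))
  near-suc⁻¹ : ∀ {a b} → Near (suc q) n a b → Near (suc q) n (suc a) (suc b)
  near-suc⁻¹ (inj₁ le) = inj₁ (s≤s le)
  near-suc⁻¹ {a} (inj₂ le) = inj₂ (≤-trans (≤-reflexive (+-suc n a)) (s≤s le))
  low' : ∀ {a b} → b < n → Far (suc q) n A' a b → b < t
  low' b<n ((b<n' , e) , far) = s<s⁻¹ (low b<n' (e , far ∘ near-suc))
  open ≤-Reasoning
  F? = far? (suc q) n A?
  F'? = far? (suc q) n A'?
  shifted : pairs F? n ≤ pairs F'? n
  shifted = begin
    pairs F? n ≤⟨ sumTo-mono n₀ (λ b b<n₀ → +-monoˡ-≤ _ (ind-false (F? 0 (suc b)) λ e → none (suc b , s<s b<n₀ , e))) ⟩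
    pairs (λ a b → F? (suc a) (suc b)) n₀
      ≤⟨ pairs-mono (λ a b → F? (suc a) (suc b)) F'? n₀ (λ a b _ b<n₀ (e , far) → (s<s b<n₀ , e) , far ∘ near-suc⁻¹) ⟩
    pairs F'? n₀ ≤⟨ sumTo-grow _ (n≤1+n n₀) ⟩
    pairs F'? n ∎
  no-loss : pairs (plus? (suc q) n A?) n ≤ pairs (plus? (suc q) n A'?) n
  no-loss = begin
    pairs (plus? (suc q) n A?) n               ≤⟨ pairs-plus≤ (suc q) n A? ⟩
    pairs F? n + pairs (near? (suc q) n) n     ≤⟨ +-monoˡ-≤ _ shifted ⟩
    pairs F'? n + pairs (near? (suc q) n) n    ≤⟨ pairs-plus≥ (suc q) n A'? ⟩
    pairs (plus? (suc q) n A'?) n              ∎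

capoyleas-pach : ∀ r n → 1 + 2 * r ≤ n → CrossBound r n
-- For r = 0 a single edge is already a forbidden chain, and no pair is near.
capoyleas-pach zero n _ {A} A? free = ≤-trans (≤-reflexive (+-identityʳ _))
  (≤-trans (sumTo-mono n λ b b<n → ≤-reflexive (count-none (λ a → plus? 0 n A? a b) b λ a a<b → absent a<b b<n))
    (≤-reflexive (sumTo-zero n)))
  where
  absent : ∀ {a b} → a < b → b < n → ¬ Plus 0 n A a b
  absent a<b b<n (inj₁ e) = free (single (e , a<b , ≤-refl , b<n))
  absent {a} a<b b<n (inj₂ (inj₁ le)) = <⇒≱ a<b (≤-trans le (≤-reflexive (+-identityʳ a)))
  absent {a} {b} a<b b<n (inj₂ (inj₂ le)) = <⇒≱ b<n (≤-trans (m≤m+n n a) (≤-trans le (≤-reflexive (+-identityʳ b))))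
capoyleas-pach (suc q) = <-rec (λ n → 1 + 2 * suc q ≤ n → CrossBound (suc q) n)
  λ n rec r≤n A? free → shift-bound q n (λ m<n → rec m<n) r≤n n A? free (λ b<n _ → b<n)

-- Short edges

count-below : {P : ℕ → Set} (P? : ∀ i → Dec (P i)) → ∀ m w → (∀ i → P i → i < w) → count P? m ≤ w
count-below P? zero    w       below = z≤n
count-below P? (suc m) zero    below = ≤-reflexive (count-none P? (suc m) λ i _ p → n≮0 (below i p))
count-below P? (suc m) (suc w) below =
  +-mono-≤ (ind≤1 (P? 0)) (count-below (P? ∘ suc) m w λ i p → s<s⁻¹ (below (suc i) p))

count-window : {P : ℕ → Set} (P? : ∀ i → Dec (P i)) → ∀ m h w → (∀ i → P i → i < h × h ≤ i + w) →
  count P? m ≤ w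
count-window P? zero    h       w window = z≤n
count-window P? (suc m) zero    w window = ≤-trans
  (≤-reflexive (count-none P? (suc m) λ i _ p → n≮0 (proj₁ (window i p)))) z≤n
count-window P? (suc m) (suc h) w window with P? 0 in eq
... | yes p = ≤-trans (≤-reflexive (cong (λ d → ind d + count (P? ∘ suc) m) (sym eq)))
  (count-below P? (suc m) w λ i pi → <-≤-trans (proj₁ (window i pi)) (proj₂ (window 0 p)))
... | no _ = count-window (P? ∘ suc) m h w λ i p →
  s<s⁻¹ (proj₁ (window (suc i) p)) , s≤s⁻¹ (proj₂ (window (suc i) p))

count-interval : {P : ℕ → Set} (P? : ∀ i → Dec (P i)) → ∀ {m} lo w → lo + w ≤ m →
  (∀ i → i < w → P (lo + i)) → w ≤ count P? m
count-interval P? {m} lo w le all = begin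
  w                                          ≤⟨ count-all (λ i → P? (lo + i)) w all ⟩
  count (λ i → P? (lo + i)) w                ≤⟨ m≤n+m _ (count P? lo) ⟩
  count P? lo + count (λ i → P? (lo + i)) w  ≡⟨ sumTo-split lo w _ ⟨
  count P? (lo + w)                          ≤⟨ sumTo-grow _ le ⟩
  count P? m                                 ∎
  where open ≤-Reasoning

sumTo-countdown : ∀ r n → sumTo n (λ j → r ∸ j) ≤ tri (suc r)
sumTo-countdown r       zero    = z≤n
sumTo-countdown zero    (suc n) = ≤-reflexive (trans (sumTo-cong n λ _ → refl) (sumTo-zero n))
sumTo-countdown (suc r) (suc n) = +-monoʳ-≤ (suc r) (sumTo-countdown r n)

short? : ∀ r a b → Dec (b ≤ a + r)
short? r a b = b ≤? a + r

-- Column `b` holds at least min(b, r) short pairs, and the shortfalls `r ∸ b` of the first columns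
-- add up to at most C(r+1,2).
short-count : ∀ r n → n * r ≤ pairs (short? r) n + tri (suc r)
short-count r n = begin
  n * r                                                    ≡⟨ sumTo-const n r ⟨
  sumTo n (λ _ → r)                                        ≡⟨ sumTo-cong n (λ b → sym (m⊓n+n∸m≡n b r)) ⟩
  sumTo n (λ b → b ⊓ r + (r ∸ b))                          ≡⟨ sumTo-+ n _ _ ⟩
  sumTo n (λ b → b ⊓ r) + sumTo n (λ b → r ∸ b)            ≤⟨ +-mono-≤ (sumTo-mono n λ b _ → column b) (sumTo-countdown r n) ⟩
  pairs (short? r) n + tri (suc r)                         ∎
  where
  open ≤-Reasoning
  column : ∀ b → b ⊓ r ≤ count (λ a → short? r a b) b
  column b = count-interval (λ a → short? r a b) (b ∸ r) (b ⊓ r)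
    (≤-reflexive (trans (+-comm (b ∸ r) (b ⊓ r)) (trans (cong (_+ (b ∸ r)) (⊓-comm b r)) (m⊓n+n∸m≡n r b))))
    (λ i _ → ≤-trans (m≤n+m∸n b r) (≤-trans (≤-reflexive (+-comm r (b ∸ r))) (+-monoˡ-≤ r (m≤m+n (b ∸ r) i))))

Window : ℕ → ℕ → ℕ → ℕ → Set
Window r v a b = a ≤ v × v ≤ b × b ≤ a + r

window? : ∀ r v a b → Dec (Window r v a b)
window? r v a b = (a ≤? v) ×-dec (v ≤? b) ×-dec (b ≤? a + r)

-- The right end `v` allows `r` left ends and the right end `v + 1 + j` allows `r ∸ j`; the total is
-- C(r+2,2) - 1.
window-count : ∀ r v n → pairs (window? r v) n ≤ r + tri (suc r)
window-count r v n = begin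
  -- The range is enlarged so that it splits at `v` wherever `v` lies relative to `n`.
  pairs (window? r v) n                        ≤⟨ sumTo-grow column (≤-trans (m≤n+m n (v + 1)) (≤-reflexive (+-assoc v 1 n))) ⟩
  sumTo (v + suc n) column                     ≡⟨ sumTo-split v (suc n) column ⟩
  sumTo v column + (column (v + 0) + sumTo n (λ j → column (v + suc j)))
    ≤⟨ +-mono-≤ before (+-mono-≤ at (≤-trans (sumTo-mono n λ j _ → after j) (sumTo-countdown r n))) ⟩
  r + tri (suc r)                              ∎
  where
  open ≤-Reasoning
  column : ℕ → ℕ
  column b = count (λ a → window? r v a b) b
  before : sumTo v column ≤ 0
  before = ≤-trans (sumTo-mono v λ b b<v → ≤-reflexive (count-none (λ a → window? r v a b) b
    λ a _ (_ , v≤b , _) → <⇒≱ b<v v≤b)) (≤-reflexive (sumTo-zero v))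
  at : column (v + 0) ≤ r
  at = subst (λ b → column b ≤ r) (sym (+-identityʳ v)) (≤-trans
    (count-mono (λ a → window? r v a v) (λ a → (a <? v) ×-dec (v ≤? a + r)) v λ a a<v (_ , _ , le) → a<v , le)
    (count-window (λ a → (a <? v) ×-dec (v ≤? a + r)) v v r λ i p → p))
  after : ∀ j → column (v + suc j) ≤ r ∸ j
  after j = count-window (λ a → window? r v a (v + suc j)) (v + suc j) (suc v) (r ∸ j) λ a (a≤v , _ , le) →
    s≤s a≤v , fits a≤v (subst (_≤ a + r) (+-suc v j) le)
    where
    fits : ∀ {a} → a ≤ v → suc v + j ≤ a + r → suc v ≤ a + (r ∸ j)
    fits {a} a≤v le = ≤-trans (m+n≤o⇒m≤o∸n (suc v) le) (≤-reflexive (+-∸-assoc a j≤r))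
      where
      j≤r : j ≤ r
      j≤r = +-cancelˡ-≤ v j r (≤-trans (n≤1+n _) (≤-trans le (+-monoˡ-≤ r a≤v)))

-- Edges listed from left to right; `lo` is the first vertex still available, and the greedy
-- piercing moves it past one right end at a time.
data Separate (P : ℕ → ℕ → Set) : ℕ → ℕ → Set where
  []  : ∀ {lo} → Separate P 0 lo
  _∷_ : ∀ {s lo x y} → lo ≤ x × P x y → Separate P s (suc y) → Separate P (suc s) lo

least : {P : ℕ → Set} (P? : ∀ i → Dec (P i)) → ∀ n →
  (∀ i → i < n → ¬ P i) ⊎ (∃ λ i → P i × (∀ j → P j → i ≤ j))
least P? zero = inj₁ λ _ ()
least P? (suc n) with P? 0
... | yes p = inj₂ (0 , p , λ _ _ → z≤n)
... | no ¬p with least (P? ∘ suc) n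
...   | inj₁ none = inj₁ λ where
          zero    _         p → ¬p p
          (suc i) (s<s i<n) p → none i i<n p
...   | inj₂ (i , p , min) = inj₂ (suc i , p , λ where
          zero    q → ⊥-elim (¬p q)
          (suc j) q → s≤s (min j q))

-- Greedy piercing: every interval starting at lo or later contains the leftmost right end, or starts after it.
separate-count : ∀ r n {P : ℕ → ℕ → Set} (P? : ∀ a b → Dec (P a b)) → (∀ {a b} → P a b → b ≤ a + r) →
  ∀ s lo → ¬ Separate P (suc s) lo →
  pairs (λ a b → (lo ≤? a) ×-dec P? a b) n ≤ s * (r + tri (suc r))
separate-count r n {P} P? short s lo none
  with least (λ b → anyUpTo? (λ a → (lo ≤? a) ×-dec P? a b) b) n
... | inj₁ empty = ≤-trans (sumTo-mono n λ b b<n → ≤-reflexive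
        (count-none (λ a → (lo ≤? a) ×-dec P? a b) b λ a a<b e → empty b b<n (a , a<b , e)))
        (≤-trans (≤-reflexive (sumTo-zero n)) z≤n)
... | inj₂ (v , (x , x<v , e) , min) with s
...   | zero   = ⊥-elim (none (e ∷ []))
...   | suc s' = ≤-trans
          (pairs-cover (λ a b → (lo ≤? a) ×-dec P? a b) (window? r v) (λ a b → (suc v ≤? a) ×-dec P? a b) n split)
          (+-mono-≤ (window-count r v n) (separate-count r n P? short s' (suc v) λ rest → none (e ∷ rest)))
  where
  split : ∀ a b → a < b → b < n → lo ≤ a × P a b → Window r v a b ⊎ (suc v ≤ a × P a b)
  split a b a<b _ p with a ≤? v
  ... | yes a≤v = inj₁ (a≤v , min b (a , a<b , p) , short (proj₂ p))
  ... | no a≰v  = inj₂ (≰⇒> a≰v , proj₂ p)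

-- Short pairs are near, so the long edges together with all short pairs obey the Capoyleas-Pach
-- bound. At least nr - C(r+1,2) of these are short pairs, which leaves rn + C(r+1,2) - C(2r+1,2)
-- for the long edges. The short edges of `P` are counted by piercing.
upper-bound : ∀ r n → 1 + 2 * r ≤ n → {P : ℕ → ℕ → Set} (P? : ∀ a b → Dec (P a b)) →
  CrossFree r n P → ¬ Separate P (suc r) 0 →
  pairs P? n + r * (1 + 2 * r) ≤ r * n + tri (suc r) + r * (r + tri (suc r))
upper-bound r n r≤n {P} P? free separate = +-cancelʳ-≤ (n * r) _ _ (begin
  pairs P? n + D + n * r                          ≤⟨ +-monoˡ-≤ (n * r) (+-monoˡ-≤ D cover) ⟩
  L + S + D + n * r                               ≤⟨ +-mono-≤ (+-monoˡ-≤ D (+-monoʳ-≤ L S≤)) (short-count r n) ⟩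
  L + W + D + (A + tri (suc r))                   ≡⟨ regroup L W D A (tri (suc r)) ⟩
  (L + A) + D + (tri (suc r) + W)                 ≤⟨ +-monoˡ-≤ _ (≤-trans (+-monoˡ-≤ D pack) (capoyleas-pach r n r≤n P? free)) ⟩
  2 * r * n + (tri (suc r) + W)                   ≡⟨ regroup' r n (tri (suc r)) W ⟩
  r * n + tri (suc r) + W + n * r                 ∎)
  where
  open ≤-Reasoning
  Long : ℕ → ℕ → Set
  Long a b = P a b × ¬ (b ≤ a + r)
  long? : ∀ a b → Dec (Long a b)
  long? a b = P? a b ×-dec ¬? (short? r a b)
  Short : ℕ → ℕ → Set
  Short a b = P a b × b ≤ a + r
  shortP? : ∀ a b → Dec (Short a b)
  shortP? a b = P? a b ×-dec short? r a b
  D = r * (1 + 2 * r)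
  L = pairs long? n
  S = pairs (λ a b → (0 ≤? a) ×-dec shortP? a b) n
  A = pairs (short? r) n
  W = r * (r + tri (suc r))
  cover : pairs P? n ≤ L + S
  cover = pairs-cover P? long? (λ a b → (0 ≤? a) ×-dec shortP? a b) n split
    where
    split : ∀ a b → a < b → b < n → P a b → Long a b ⊎ (0 ≤ a × Short a b)
    split a b _ _ p with short? r a b
    ... | yes s = inj₂ (z≤n , p , s)
    ... | no ¬s = inj₁ (p , ¬s)
  forget : ∀ {s lo} → Separate Short s lo → Separate P s lo
  forget []                        = []
  forget ((lo≤x , p , _) ∷ rest) = (lo≤x , p) ∷ forget rest
  S≤ : S ≤ W
  S≤ = separate-count r n shortP? proj₂ r 0 (separate ∘ forget)
  pack : L + A ≤ pairs (plus? r n P?) n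
  pack = pairs-pack long? (short? r) (plus? r n P?) n (λ _ _ _ _ → inj₁ ∘ proj₁) (λ _ _ _ _ → inj₂ ∘ inj₁)
    (λ _ _ _ _ (_ , ¬s) s → ¬s s)
  regroup : ∀ l w d a t → l + w + d + (a + t) ≡ (l + a) + d + (t + w)
  regroup = solve-∀
  regroup' : ∀ r n t w → 2 * r * n + (t + w) ≡ r * n + t + w + n * r
  regroup' = solve-∀

-- Ordered graphs on Fin n

sum-allFin : ∀ n (f : Fin n → ℕ) (g : ℕ → ℕ) → (∀ i → f i ≡ g (toℕ i)) → sum (map f (allFin n)) ≡ sumTo n g
sum-allFin n f g f≡g = trans (cong sum (List.map-tabulate id f)) (go n f g f≡g)
  where
  go : ∀ n (f : Fin n → ℕ) (g : ℕ → ℕ) → (∀ i → f i ≡ g (toℕ i)) → sum (tabulate f) ≡ sumTo n g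
  go zero    f g f≡g = refl
  go (suc n) f g f≡g = cong₂ _+_ (f≡g Fin.zero) (go n (f ∘ Fin.suc) (g ∘ suc) (f≡g ∘ Fin.suc))

ind-if : {P : Set} (c : Bool) (P? : Dec P) → (c ≡ true → P) → (P → c ≡ true) → (if c then 1 else 0) ≡ ind P?
ind-if true  (yes _) _ _ = refl
ind-if true  (no ¬p) f _ = ⊥-elim (¬p (f refl))
ind-if false (yes p) _ g with g p
... | ()
ind-if false (no _)  _ _ = refl

module _ {n : ℕ} (G : OGraph n) where

  Edge : ℕ → ℕ → Set
  Edge a b = ∃ λ i → ∃ λ j → toℕ i ≡ a × toℕ j ≡ b × IsEdge G i j

  edge? : ∀ a b → Dec (Edge a b)
  edge? a b = Fin.any? λ i → Fin.any? λ j →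
    (toℕ i ≟ a) ×-dec (toℕ j ≟ b) ×-dec (i Fin.<? j) ×-dec (adj G i j Bool.≟ true)

  edgeCount-rows : edgeCount G ≡ sumTo n (λ a → count (edge? a) n)
  edgeCount-rows = sum-allFin n _ _ λ i → sum-allFin n _ _ λ j →
    ind-if (⌊ i Fin.<? j ⌋ ∧ adj G i j) (edge? (toℕ i) (toℕ j)) (into i j) (out i j)
    where
    into : ∀ i j → ⌊ i Fin.<? j ⌋ ∧ adj G i j ≡ true → Edge (toℕ i) (toℕ j)
    into i j eq with i Fin.<? j
    ... | yes i<j = i , j , refl , refl , i<j , eq
    into i j () | no _
    out : ∀ i j → Edge (toℕ i) (toℕ j) → ⌊ i Fin.<? j ⌋ ∧ adj G i j ≡ true
    out i j (i' , j' , eqi , eqj , i<j , e) with Fin.toℕ-injective eqi | Fin.toℕ-injective eqj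
    ... | refl | refl = cong₂ _∧_ (trans (isYes≗does (i Fin.<? j)) (dec-true (i Fin.<? j) i<j)) e

  edgeCount-pairs : edgeCount G ≤ pairs edge? n
  edgeCount-pairs = ≤-trans (≤-reflexive (trans edgeCount-rows (sumTo-swap n n _))) (sumTo-mono n column)
    where
    column : ∀ b → b < n → count (λ a → edge? a b) n ≤ count (λ a → edge? a b) b
    column b b<n with m≤n⇒∃[o]m+o≡n (<⇒≤ b<n)
    ... | o , refl = begin
      count (λ a → edge? a b) (b + o)   ≡⟨ sumTo-split b o _ ⟩
      count (λ a → edge? a b) b + count (λ a → edge? (b + a) b) o
        ≡⟨ cong (count (λ a → edge? a b) b +_) (count-none (λ a → edge? (b + a) b) o beyond) ⟩
      count (λ a → edge? a b) b + 0     ≡⟨ +-identityʳ _ ⟩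
      count (λ a → edge? a b) b         ∎
      where
      open ≤-Reasoning
      beyond : ∀ a → a < o → ¬ Edge (b + a) b
      beyond a _ (i , j , eqi , eqj , i<j , _) =
        <⇒≱ (subst₂ _<_ eqi eqj i<j) (m≤m+n b a)

  -- `R` is an arbitrary relation without assumed symmetry, hence both orders are asked for.
  ordered-matching : ∀ {k} (R : Fin n → Fin n → Fin n → Fin n → Set) (x y : Fin k → Fin n) →
    (∀ a → IsEdge G (x a) (y a)) →
    (∀ {a b} → a Fin.< b → Disjoint (x a) (y a) (x b) (y b) × R (x a) (y a) (x b) (y b)) →
    (∀ {a b} → a Fin.< b → Disjoint (x b) (y b) (x a) (y a) × R (x b) (y b) (x a) (y a)) →
    HasMatching R G k
  ordered-matching R x y edges up down = x , y , edges , any-order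
    where
    any-order : ∀ a b → a ≢ b → Disjoint (x a) (y a) (x b) (y b) × R (x a) (y a) (x b) (y b)
    any-order a b a≢b with Fin.<-cmp a b
    ... | tri< a<b _ _ = up a<b
    ... | tri≈ _ a≡b _ = ⊥-elim (a≢b a≡b)
    ... | tri> _ _ b<a = down b<a

  <⇒≢ᶠ : {i j : Fin n} → i Fin.< j → i ≢ j
  <⇒≢ᶠ i<j refl = <-irrefl refl i<j

  -- Index 0 is the last edge of the chain, so the numbering runs downwards. The bounds by `x` and
  -- `y` let the induction compare a new last edge with all earlier ones.
  chain-points : ∀ {c l x y} → Chain (Over n c Edge) l x y →
    Σ (Fin (suc l) → Fin n) λ xs → Σ (Fin (suc l) → Fin n) λ ys →
      (∀ a → IsEdge G (xs a) (ys a) × toℕ (xs a) ≤ x × toℕ (ys a) ≤ y × toℕ (xs a) < c × c ≤ toℕ (ys a)) ×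
      (∀ {a b} → a Fin.< b → xs b Fin.< xs a × ys b Fin.< ys a)
  chain-points (single ((i , j , refl , refl , e) , i<c , c≤j , _)) =
    (λ _ → i) , (λ _ → j) , (λ _ → e , ≤-refl , ≤-refl , i<c , c≤j) , λ { {Fin.zero} {Fin.zero} () }
  chain-points {c} {suc l} {x} {y} (extend ch u v ((i , j , refl , refl , e) , i<c , c≤j , _))
    with chain-points ch
  ... | xs₀ , ys₀ , at₀ , order₀ = xs , ys , at , order
    where
    xs ys : Fin (suc (suc l)) → Fin n
    xs Fin.zero    = i
    xs (Fin.suc a) = xs₀ a
    ys Fin.zero    = j
    ys (Fin.suc a) = ys₀ a
    at : ∀ a → IsEdge G (xs a) (ys a) × toℕ (xs a) ≤ x × toℕ (ys a) ≤ y × toℕ (xs a) < c × c ≤ toℕ (ys a)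
    at Fin.zero    = e , ≤-refl , ≤-refl , i<c , c≤j
    at (Fin.suc a) with at₀ a
    ... | e' , x≤ , y≤ , x<c , c≤y = e' , ≤-trans x≤ (<⇒≤ u) , ≤-trans y≤ (<⇒≤ v) , x<c , c≤y
    order : ∀ {a b} → a Fin.< b → xs b Fin.< xs a × ys b Fin.< ys a
    order {Fin.zero}  {Fin.suc b} _         = ≤-<-trans (proj₁ (proj₂ (at₀ b))) u , ≤-<-trans (proj₁ (proj₂ (proj₂ (at₀ b)))) v
    order {Fin.suc a} {Fin.suc b} (s<s a<b) = order₀ a<b

  -- All edges straddle `c`, so every left end precedes every right end, which excludes separation;
  -- both ends increase strictly, which excludes nesting.
  crossFree : ∀ {r} → ¬ HasCrossM G (suc r) → CrossFree r n Edge
  crossFree none ch with chain-points ch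
  ... | xs , ys , at , order = none (ordered-matching Crossing xs ys (proj₁ ∘ at) back forth)
    where
    back : ∀ {a b} → a Fin.< b → Disjoint (xs a) (ys a) (xs b) (ys b) × Crossing (xs a) (ys a) (xs b) (ys b)
    forth : ∀ {a b} → a Fin.< b → Disjoint (xs b) (ys b) (xs a) (ys a) × Crossing (xs b) (ys b) (xs a) (ys a)
    mixed : ∀ a b → xs a Fin.< ys b
    mixed a b = <-≤-trans (proj₁ (proj₂ (proj₂ (proj₂ (at a))))) (proj₂ (proj₂ (proj₂ (proj₂ (at b)))))
    back {a} {b} a<b with order a<b
    ... | x< , y< = (<⇒≢ᶠ x< ∘ sym , <⇒≢ᶠ (mixed a b) , <⇒≢ᶠ (mixed b a) ∘ sym , <⇒≢ᶠ y< ∘ sym) ,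
      [ <-asym (mixed b a) , <-asym (mixed a b) ]′ ,
      [ (λ (le , _) → <⇒≱ x< le) , (λ (_ , le) → <⇒≱ y< le) ]′
    forth {a} {b} a<b with order a<b
    ... | x< , y< = (<⇒≢ᶠ x< , <⇒≢ᶠ (mixed b a) , <⇒≢ᶠ (mixed a b) ∘ sym , <⇒≢ᶠ y<) ,
      [ <-asym (mixed a b) , <-asym (mixed b a) ]′ ,
      [ (λ (_ , le) → <⇒≱ y< le) , (λ (le , _) → <⇒≱ x< le) ]′

  separate-points : ∀ {s lo} → Separate Edge s lo →
    Σ (Fin s → Fin n) λ xs → Σ (Fin s → Fin n) λ ys →
      (∀ a → IsEdge G (xs a) (ys a) × lo ≤ toℕ (xs a)) ×
      (∀ {a b} → a Fin.< b → ys a Fin.< xs b)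
  separate-points [] = (λ ()) , (λ ()) , (λ ()) , λ { {()} }
  separate-points {suc s} {lo} ((lo≤x , i , j , refl , refl , e) ∷ rest) with separate-points rest
  ... | xs₀ , ys₀ , at₀ , order₀ = xs , ys , at , order
    where
    xs ys : Fin (suc s) → Fin n
    xs Fin.zero    = i
    xs (Fin.suc a) = xs₀ a
    ys Fin.zero    = j
    ys (Fin.suc a) = ys₀ a
    at : ∀ a → IsEdge G (xs a) (ys a) × lo ≤ toℕ (xs a)
    at Fin.zero    = e , lo≤x
    at (Fin.suc a) = proj₁ (at₀ a) , ≤-trans lo≤x (≤-trans (<⇒≤ (proj₁ e)) (<⇒≤ (proj₂ (at₀ a))))
    order : ∀ {a b} → a Fin.< b → ys a Fin.< xs b
    order {Fin.zero}  {Fin.suc b} _         = proj₂ (at₀ b)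
    order {Fin.suc a} {Fin.suc b} (s<s a<b) = order₀ a<b

  not-separate : ∀ {k} → ¬ HasSepM G k → ¬ Separate Edge k 0
  not-separate none sep with separate-points sep
  ... | xs , ys , at , order = none (ordered-matching Separated xs ys (proj₁ ∘ at)
    (λ a<b → forward a<b , inj₁ (order a<b)) (λ a<b → backward a<b , inj₂ (order a<b)))
    where
    edge< : ∀ a → xs a Fin.< ys a
    edge< a = proj₁ (proj₁ (at a))
    y<y : ∀ {a b} → a Fin.< b → ys a Fin.< ys b
    y<y {b = b} a<b = <-trans (order a<b) (edge< b)
    x<x : ∀ {a b} → a Fin.< b → xs a Fin.< xs b
    x<x {a} a<b = <-trans (edge< a) (order a<b)
    x<y : ∀ {a b} → a Fin.< b → xs a Fin.< ys b
    x<y {a} a<b = <-trans (edge< a) (y<y a<b)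
    forward : ∀ {a b} → a Fin.< b → Disjoint (xs a) (ys a) (xs b) (ys b)
    forward a<b = <⇒≢ᶠ (x<x a<b) , <⇒≢ᶠ (x<y a<b) , <⇒≢ᶠ (order a<b) , <⇒≢ᶠ (y<y a<b)
    backward : ∀ {a b} → a Fin.< b → Disjoint (xs b) (ys b) (xs a) (ys a)
    backward a<b = <⇒≢ᶠ (x<x a<b) ∘ sym , <⇒≢ᶠ (order a<b) ∘ sym , <⇒≢ᶠ (x<y a<b) ∘ sym , <⇒≢ᶠ (y<y a<b) ∘ sym

edgeCount-bound : ∀ {n} r → 1 + 2 * r ≤ n → (G : OGraph n) → Free G (suc r) →
  edgeCount G + r * (1 + 2 * r) ≤ r * n + tri (suc r) + r * (r + tri (suc r))
edgeCount-bound {n} r r≤n G (noCross , noSep) = ≤-trans (+-monoˡ-≤ _ (edgeCount-pairs G))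
  (upper-bound r n r≤n (edge? G) (crossFree G noCross) (not-separate G noSep))

tri-C : ∀ n → tri n ≡ n C 2
tri-C zero    = refl
tri-C (suc n) = trans (cong₂ _+_ (sym (nC1≡n n)) (tri-C n)) (nCk+nC[k+1]≡[n+1]C[k+1] n 1)

-- The extremal graph

module Extremal (r n : ℕ) where

  -- The last vertex of block `t`, where the vertices are cut into blocks of `suc r`; the rows are
  -- later summed block by block.
  pivot : ℕ → ℕ
  pivot t = t * suc r + r

  Ext : ℕ → ℕ → Set
  Ext a b = (a < r × r ≤ b) ⊎ (∃ λ t → t < r × Window r (pivot t) a b)

  ext? : ∀ a b → Dec (Ext a b)
  ext? a b = ((a <? r) ×-dec (r ≤? b)) ⊎-dec anyUpTo? (λ t → window? r (pivot t) a b) r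

  extremal : OGraph n
  extremal = record { adj = λ i j → ⌊ ext? (toℕ i) (toℕ j) ⌋ }

  edge-ext : ∀ {i j} → IsEdge extremal i j → Ext (toℕ i) (toℕ j)
  edge-ext {i} {j} (_ , e) with ext? (toℕ i) (toℕ j)
  ... | yes p = p
  edge-ext (_ , ()) | no _

  -- Edges of the first kind contain the vertex `r`, which is `pivot 0`.
  pierced : ∀ {a b} → Ext a b → ∃ λ t → t < r × a ≤ pivot t × pivot t ≤ b
  pierced (inj₁ (a<r , r≤b)) = 0 , ≤-<-trans z≤n a<r , <⇒≤ a<r , r≤b
  pierced (inj₂ (t , t<r , a≤ , ≤b , _)) = t , t<r , a≤ , ≤b

  -- Each of the `r + 1` edges contains one of `r` pivots, so two of them share a pivot.
  no-separated : ¬ HasSepM extremal (suc r)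
  no-separated (x , y , edges , apart)
    with Fin.pigeonhole (n<1+n r) (λ a → Fin.fromℕ< (proj₁ (proj₂ (pierced (edge-ext (edges a))))))
  ... | a , b , a<b , same = [ (λ y<x → <-irrefl refl (<-≤-trans (≤-<-trans (above a) y<x)
              (subst (toℕ (x b) ≤_) (sym eq) (below b)))) ,
          (λ y<x → <-irrefl refl (<-≤-trans (≤-<-trans (subst (_≤ toℕ (y b)) (sym eq) (above b)) y<x) (below a))) ]′
          (proj₂ (apart a b (λ { refl → <-irrefl refl a<b })))
    where
    piv : Fin (suc r) → ℕ
    piv a = pivot (proj₁ (pierced (edge-ext (edges a))))
    below : ∀ a → toℕ (x a) ≤ piv a
    below a = proj₁ (proj₂ (proj₂ (pierced (edge-ext (edges a)))))
    above : ∀ a → piv a ≤ toℕ (y a)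
    above a = proj₂ (proj₂ (proj₂ (pierced (edge-ext (edges a)))))
    eq : piv a ≡ piv b
    eq = cong pivot (Fin.fromℕ<-injective _ _ _ _ same)

  -- An edge of length at most r has fewer than r interior vertices, one for each edge crossing it.
  no-short-crossed : ∀ (x y : Fin (suc r) → Fin n) a → 0 < r → toℕ (y a) ≤ toℕ (x a) + r →
    ¬ (∀ b c → b ≢ c → Disjoint (x b) (y b) (x c) (y c) × Crossing (x b) (y b) (x c) (y c))
  no-short-crossed x y a 0<r short cross = collide (Fin.pigeonhole (n<1+n r) (proj₁ ∘ slot))
    where
    xa = toℕ (x a)
    -- Slot 0 is reserved for the edge `a` itself, and slot `p > 0` for an edge with an end at
    -- `xa + p`; `r + 1` edges then compete for `r` slots.
    Slot : Fin (suc r) → Fin r → Set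
    Slot b p = (b ≡ a × toℕ p ≡ 0) ⊎ (0 < toℕ p × (toℕ (x b) ≡ xa + toℕ p ⊎ toℕ (y b) ≡ xa + toℕ p))
    place : ∀ z → xa < z → z < toℕ (y a) → ∃ λ (p : Fin r) → 0 < toℕ p × z ≡ xa + toℕ p
    place z xa<z z<ya = Fin.fromℕ< d<r , subst (0 <_) (sym toℕ-p) (m<n⇒0<n∸m xa<z) ,
      trans (sym (m+[n∸m]≡n (<⇒≤ xa<z))) (cong (xa +_) (sym toℕ-p))
      where
      d<r : z ∸ xa < r
      d<r = +-cancelˡ-< xa _ _ (<-≤-trans (subst (_< toℕ (y a)) (sym (m+[n∸m]≡n (<⇒≤ xa<z))) z<ya) short)
      toℕ-p : toℕ (Fin.fromℕ< d<r) ≡ z ∸ xa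
      toℕ-p = Fin.toℕ-fromℕ< d<r
    slot : ∀ b → ∃ (Slot b)
    slot b with b Fin.≟ a
    ... | yes b≡a = Fin.fromℕ< 0<r , inj₁ (b≡a , Fin.toℕ-fromℕ< 0<r)
    ... | no b≢a with cross a b (b≢a ∘ sym)
    ...   | (x≢x , x≢y , y≢x , y≢y) , ¬sep , ¬nest with <-cmp xa (toℕ (x b))
    ...     | tri≈ _ eq _ = ⊥-elim (x≢x (Fin.toℕ-injective eq))
    ...     | tri< xa<xb _ _ with place (toℕ (x b)) xa<xb
                (≤∧≢⇒< (≮⇒≥ (¬sep ∘ inj₁)) (y≢x ∘ sym ∘ Fin.toℕ-injective))
    ...       | p , 0<p , eq = p , inj₂ (0<p , inj₁ eq)
    slot b | no b≢a | (x≢x , x≢y , y≢x , y≢y) , ¬sep , ¬nest | tri> _ _ xb<xa with place (toℕ (y b))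
                (≤∧≢⇒< (≮⇒≥ (¬sep ∘ inj₂)) (x≢y ∘ Fin.toℕ-injective))
                (≰⇒> λ ya≤yb → ¬nest (inj₂ (<⇒≤ xb<xa , ya≤yb)))
    ...       | p , 0<p , eq = p , inj₂ (0<p , inj₂ eq)
    clash : ∀ {b c p} → b ≢ c → Slot b p → Slot c p → ⊥
    clash b≢c (inj₁ (refl , _)) (inj₁ (refl , _)) = b≢c refl
    clash b≢c (inj₁ (_ , p≡0)) (inj₂ (0<p , _)) = <-irrefl (sym p≡0) 0<p
    clash b≢c (inj₂ (0<p , _)) (inj₁ (_ , p≡0)) = <-irrefl (sym p≡0) 0<p
    clash {b} {c} b≢c (inj₂ (_ , ends)) (inj₂ (_ , ends')) with proj₁ (cross b c b≢c)
    ... | x≢x , x≢y , y≢x , y≢y with ends | ends'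
    ...   | inj₁ e | inj₁ e' = x≢x (Fin.toℕ-injective (trans e (sym e')))
    ...   | inj₁ e | inj₂ e' = x≢y (Fin.toℕ-injective (trans e (sym e')))
    ...   | inj₂ e | inj₁ e' = y≢x (Fin.toℕ-injective (trans e (sym e')))
    ...   | inj₂ e | inj₂ e' = y≢y (Fin.toℕ-injective (trans e (sym e')))
    collide : (∃ λ b → ∃ λ c → b Fin.< c × proj₁ (slot b) ≡ proj₁ (slot c)) → ⊥
    collide (b , c , b<c , same) = clash (λ { refl → <-irrefl refl b<c })
      (proj₂ (slot b)) (subst (Slot c) (sym same) (proj₂ (slot c)))

  -- The left ends cannot all lie among the first `r` vertices, by the pigeonhole principle. An edge
  -- with a later left end is of the window kind, hence too short to be crossed by `r` disjoint
  -- edges.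
  no-crossing : ¬ HasCrossM extremal (suc r)
  no-crossing (x , y , edges , cross) with Fin.any? (λ a → r ≤? toℕ (x a))
  ... | no none with Fin.pigeonhole (n<1+n r) (λ a → Fin.fromℕ< (≰⇒> λ le → none (a , le)))
  ...   | a , b , a<b , same = proj₁ (proj₁ (cross a b (λ { refl → <-irrefl refl a<b })))
          (Fin.toℕ-injective (Fin.fromℕ<-injective _ _ _ _ same))
  no-crossing (x , y , edges , cross) | yes (a , r≤x) with edge-ext (edges a)
  ... | inj₁ (x<r , _) = <⇒≱ x<r r≤x
  ... | inj₂ (t , t<r , _ , _ , short) = no-short-crossed x y a (≤-<-trans z≤n t<r) short cross

  extremal-free : Free extremal (suc r)
  extremal-free = no-crossing , no-separated

-- Size of the extremal graph

sumTo-product : ∀ m w (f : ℕ → ℕ) → sumTo (m * w) f ≡ sumTo m (λ t → sumTo w (λ u → f (t * w + u)))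
sumTo-product zero    w f = refl
sumTo-product (suc m) w f = trans (sumTo-split w (m * w) f) (cong (sumTo w f +_)
  (trans (sumTo-product m w (λ i → f (w + i)))
    (sumTo-cong m λ t → sumTo-cong w λ u → cong f (sym (+-assoc w (t * w) u)))))

module _ (q n : ℕ) (large : 2 * (suc (suc q) * suc (suc q)) ≤ n) where

  open Extremal (suc q) n
  private r = suc q

  ext-edge : ∀ {a b} → a < b → b < n → Ext a b → Edge extremal a b
  ext-edge {a} {b} a<b b<n e = i , j , eqi , eqj , subst₂ _<_ (sym eqi) (sym eqj) a<b ,
    trans (isYes≗does (ext? _ _)) (dec-true (ext? _ _) (subst₂ Ext (sym eqi) (sym eqj) e))
    where
    i = Fin.fromℕ< (<-trans a<b b<n)
    j = Fin.fromℕ< b<n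
    eqi : toℕ i ≡ a
    eqi = Fin.toℕ-fromℕ< (<-trans a<b b<n)
    eqj : toℕ j ≡ b
    eqj = Fin.toℕ-fromℕ< b<n

  open ≤-Reasoning

  room : ∀ {t} → t < r → suc (pivot t) + r ≤ n
  room {t} t<r = begin
    suc (t * suc r + r) + r       ≡⟨ cong (_+ r) (trans (sym (+-suc (t * suc r) r)) (+-comm (t * suc r) (suc r))) ⟩
    suc t * suc r + r             ≤⟨ +-mono-≤ (*-monoˡ-≤ (suc r) t<r) (n≤1+n r) ⟩
    r * suc r + suc r             ≡⟨ +-comm (r * suc r) (suc r) ⟩
    suc r * suc r                 ≤⟨ m≤n*m (suc r * suc r) 2 ⟩
    2 * (suc r * suc r)           ≤⟨ large ⟩
    n                             ∎

  r≤n : r ≤ n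
  r≤n = ≤-trans (m≤n+m r (suc (pivot 0))) (room {0} z<s)

  row : ℕ → ℕ
  row a = count (edge? extremal a) n

  row-interval : ∀ {a} lo w → a < lo → lo + w ≤ n →
    (∀ i → i < w → Ext a (lo + i)) → w ≤ row a
  row-interval {a} lo w a<lo le ext = count-interval (edge? extremal a) lo w le λ i i<w →
    ext-edge (<-≤-trans a<lo (m≤m+n lo i)) (<-≤-trans (+-monoʳ-< lo i<w) le) (ext i i<w)

  pivot-row : ∀ {t} → t < r → r ≤ row (pivot t)
  pivot-row {t} t<r = row-interval (suc (pivot t)) r ≤-refl (room t<r) λ i i<r →
    inj₂ (t , t<r , ≤-refl , ≤-trans (n≤1+n _) (m≤m+n _ i) ,
      ≤-trans (≤-reflexive (sym (+-suc (pivot t) i))) (+-monoʳ-≤ (pivot t) i<r))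

  star-row : ∀ {u} → u < r → n ∸ r ≤ row u
  star-row {u} u<r = row-interval r (n ∸ r) u<r (≤-reflexive (m+[n∸m]≡n r≤n))
    λ i _ → inj₁ (u<r , m≤m+n r i)

  window-row : ∀ {t u} → t < r → u < r → suc u ≤ row (t * suc r + u)
  window-row {t} {u} t<r u<r = row-interval (pivot t) (suc u) (+-monoʳ-< (t * suc r) u<r)
    (≤-trans (+-monoʳ-≤ (pivot t) u<r) (≤-trans (n≤1+n _) (room t<r)))
    λ i i≤u → inj₂ (t , t<r , +-monoʳ-≤ (t * suc r) (<⇒≤ u<r) , m≤m+n (pivot t) i ,
      (begin
        t * suc r + r + i   ≤⟨ +-monoʳ-≤ (t * suc r + r) (s≤s⁻¹ i≤u) ⟩
        t * suc r + r + u   ≡⟨ trans (+-assoc (t * suc r) r u) (trans (cong (t * suc r +_) (+-comm r u)) (sym (+-assoc (t * suc r) u r))) ⟩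
        t * suc r + u + r   ∎))

  -- In block 0 the first `r` rows have `n ∸ r` edges each and the pivot row has `r`. In each of the
  -- other `q` blocks, row `u < r` reaches from the pivot to `u` places beyond it, giving C(r+1,2)
  -- in all, and the pivot row again gives `r`.
  extremal-count : (r * (n ∸ r) + r) + q * (tri (suc r) + r) ≤ edgeCount extremal
  extremal-count = begin
    (r * (n ∸ r) + r) + q * (tri (suc r) + r)
      ≡⟨ cong₂ (λ s t → (s + r) + t) (sumTo-const r (n ∸ r)) (sumTo-const q (tri (suc r) + r)) ⟨
    (sumTo r (λ _ → n ∸ r) + r) + sumTo q (λ _ → tri (suc r) + r)
      ≤⟨ +-mono-≤ (+-mono-≤ (sumTo-mono r λ u → star-row) (pivot-row {0} z<s))
           (sumTo-mono q λ t t<q → +-mono-≤ (window-rows t t<q) (pivot-row (s<s t<q))) ⟩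
    (sumTo r row + row r) + sumTo q (λ t → sumTo r (λ u → row (suc t * suc r + u)) + row (suc t * suc r + r))
      ≡⟨ cong₂ _+_ (sumTo-last r row) (sumTo-cong q λ t → sumTo-last r (λ u → row (suc t * suc r + u))) ⟨
    sumTo r (λ t → sumTo (suc r) (λ u → row (t * suc r + u)))
      ≡⟨ sumTo-product r (suc r) row ⟨
    sumTo (r * suc r) row
      ≤⟨ sumTo-grow row (≤-trans (m≤n+m _ (suc r)) (≤-trans (m≤n*m (suc r * suc r) 2) large)) ⟩
    sumTo n row
      ≡⟨ edgeCount-rows extremal ⟨
    edgeCount extremal ∎
    where
    window-rows : ∀ t → t < q → tri (suc r) ≤ sumTo r (λ u → row (suc t * suc r + u))
    window-rows t t<q = ≤-trans (≤-reflexive (sym (sumTo-id (suc r))))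
      (sumTo-mono r λ u u<r → window-row (s<s t<q) u<r)

  extremal-bound : r * n + tri (suc r) + r * (r + tri (suc r)) ≤ edgeCount extremal + r * (1 + 2 * r)
  extremal-bound = begin
    r * n + T + r * (r + T)                        ≡⟨ cong (λ t → r * t + T + r * (r + T)) (m+[n∸m]≡n r≤n) ⟨
    r * (r + m) + T + r * (r + T)                  ≡⟨ expand q m T ⟩
    -- The surplus `r * r + (T + T)` is C(2r+1,2), since `T + T` is `r * suc r`.
    (r * m + r) + q * (T + r) + (r * r + (T + T))  ≡⟨ cong (λ t → (r * m + r) + q * (T + r) + (r * r + t)) double ⟩
    (r * m + r) + q * (T + r) + (r * r + r * suc r) ≡⟨ cong ((r * m + r) + q * (T + r) +_) (collect r) ⟩
    (r * m + r) + q * (T + r) + r * (1 + 2 * r)    ≤⟨ +-monoˡ-≤ _ extremal-count ⟩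
    edgeCount extremal + r * (1 + 2 * r)           ∎
    where
    T = tri (suc r)
    m = n ∸ r
    double : T + T ≡ r * suc r
    double = +-cancelʳ-≡ (suc r) _ _ (trans (tri-double (suc r)) (+-comm (suc r) (r * suc r)))
    expand : ∀ q m t → suc q * (suc q + m) + t + suc q * (suc q + t) ≡
      (suc q * m + suc q) + q * (t + suc q) + (suc q * suc q + (t + t))
    expand = solve-∀
    collect : ∀ r → r * r + r * suc r ≡ r * (1 + 2 * r)
    collect = solve-∀

-- The two bounds in binomial form

odd-C : ∀ r → (2 * suc r ∸ 1) C 2 ≡ r * (1 + 2 * r)
odd-C r = trans (cong (_C 2) (+-suc r (r + 0))) (trans (sym (tri-C (1 + 2 * r))) (tri-odd r))

window-C : ∀ r → ((suc r + 1) C 2) ∸ 1 ≡ r + tri (suc r)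
window-C r = cong (_∸ 1) (trans (cong (_C 2) (+-comm (suc r) 1)) (sym (tri-C (2 + r))))

theorem2p6 : (n k : ℕ) → 1 ≤ k → 2 * k ≤ n →
    (((G : OGraph n) → Free G k →
    edgeCount G + ((2 * k ∸ 1) C 2)
    ≤ (k ∸ 1) * n + (k C 2) + (k ∸ 1) * (((k + 1) C 2) ∸ 1))
    × (2 * (k * k) ≤ n →
    Σ (OGraph n) λ G → Free G k ×
    (edgeCount G + ((2 * k ∸ 1) C 2)
    ≡ (k ∸ 1) * n + (k C 2) + (k ∸ 1) * (((k + 1) C 2) ∸ 1))))
theorem2p6 n (suc r) _ 2k≤n = upper , λ large → extremal , extremal-free ,
  ≤-antisym (upper extremal extremal-free)
    (subst₂ _≤_ (sym bound-C) (cong (edgeCount extremal +_) (sym (odd-C r))) (lower r large))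
  where
  open Extremal r n
  bound-C : r * n + (suc r C 2) + r * (((suc r + 1) C 2) ∸ 1) ≡ r * n + tri (suc r) + r * (r + tri (suc r))
  bound-C = cong₂ (λ s t → r * n + s + r * t) (sym (tri-C (suc r))) (window-C r)
  upper : (G : OGraph n) → Free G (suc r) →
    edgeCount G + ((2 * suc r ∸ 1) C 2) ≤ r * n + (suc r C 2) + r * (((suc r + 1) C 2) ∸ 1)
  upper G free = subst₂ _≤_ (cong (edgeCount G +_) (sym (odd-C r))) (sym bound-C)
    (edgeCount-bound r (≤-trans (s≤s (+-monoʳ-≤ r (n≤1+n (r + 0)))) 2k≤n) G free)
  lower : ∀ r → 2 * (suc r * suc r) ≤ n →
    r * n + tri (suc r) + r * (r + tri (suc r)) ≤ edgeCount (Extremal.extremal r n) + r * (1 + 2 * r)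
  -- For k = 1 the left side vanishes; the block count is set up for r = `suc q`.
  lower zero    _     = z≤n
  lower (suc q) large = extremal-bound q n large
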